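{- Let $p\ge3$ and let $\Gamma=\{\alpha^{(1)},\dots,\alpha^{(k)}\}$ be a set of minimal overlapping permutations in $S_p$, all starting with $1$, such that $\alpha^{(i)}$ and $\alpha^{(j)}$ are mutually minimal overlapping for all $1\le i<j\le k$. For each $i$ let $s_i$ be the last element of $\alpha^{(i)}$. Define $\mathrm{IU}_{\Gamma,n}(q,z)$ by \[ 1+\sum_{n\ge1}\mathrm{IU}_{\Gamma,n}(q,z)\frac{t^n}{[n]_q!}=\frac{1}{\mathrm{INM}_\Gamma(t,q,z)}, \] and set $\mathrm{IU}_{\Gamma,0}(q,z)=1$. Then $\mathrm{IU}_{\Gamma,1}(q,z)=-z$, and for $n\ge2$, \[ \mathrm{IU}_{\Gamma,n}(q,z)=(1-z)\,\mathrm{IU}_{\Gamma,n-1}(q,z)-\sum_{i=1}^k z^{\mathrm{des}(\alpha^{(i)})}q^{\mathrm{inv}(\alpha^{(i)})}\begin{bmatrix} n-s_i\\ p-s_i\end{bmatrix}_q\mathrm{IU}_{\Gamma,n-p+1}(q,z), \] where terms with $n<p$ are interpreted as $0$ (the $q$-binomial coefficient then vanishes).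
   Context: For $\sigma\in S_n$: $\mathrm{des}(\sigma)=|\{i:\sigma_i>\sigma_{i+1}\}|$, $\mathrm{inv}(\sigma)=|\{(i,k):i<k,\sigma_i>\sigma_k\}|$. $\mathrm{red}(w)$ replaces the $i$-th smallest entry of a sequence of distinct integers by $i$; for $\tau\in S_p$, $\sigma$ has a $\tau$-match at position $i$ if $\mathrm{red}(\sigma_i\cdots\sigma_{i+p-1})=\tau$, and a $\Gamma$-match if this reduction lies in $\Gamma$; $\mathcal{NM}_n(\Gamma)$ is the set of $\sigma\in S_n$ with no $\Gamma$-match. $\tau\in S_p$ is minimal overlapping if the smallest $i$ such that some $\sigma\in S_i$ has exactly two $\tau$-matches is $2p-1$. $\alpha,\beta\in S_p$ are mutually minimal overlapping if both are minimal overlapping and the smallest $n$ such that some $\sigma\in S_n$ has at least one $\alpha$-match and at least one $\beta$-match is $2p-1$. $[n]_q=1+q+\cdots+q^{n-1}$, $[n]_q!=[1]_q\cdots[n]_q$, $[0]_q!=1$, $\begin{bmatrix} m\\ k\end{bmatrix}_q=\frac{[m]_q!}{[k]_q![m-k]_q!}$ for $0\le k\le m$ and $0$ otherwise. $\mathrm{INM}_{\Gamma,n}(q,z)=\sum_{\sigma\in\mathcal{NM}_n(\Gamma)}z^{\mathrm{des}(\sigma)+1}q^{\mathrm{inv}(\sigma)}$ and $\mathrm{INM}_\Gamma(t,q,z)=1+\sum_{n\ge1}\frac{t^n}{[n]_q!}\mathrm{INM}_{\Gamma,n}(q,z)$. -}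

module Defs where

open import Level using (Level)
import Data.Nat as N
open import Data.Nat using (ℕ; zero; suc; _∸_; _≤_; _<_; _<?_)
open import Data.Nat.Properties using () renaming (_≟_ to _≟ℕ_)
open import Data.List using (List; []; _∷_; map; filter; length; take; drop; upTo; concatMap; foldr; foldl)
open import Data.List.Properties using (≡-dec)
open import Data.List.Relation.Unary.All using (All)
open import Data.List.Relation.Unary.Any using (any?)
open import Data.List.Relation.Unary.Unique.Propositional using (Unique)
import Data.List.Relation.Unary.Unique.DecPropositional as UD
open import Data.List.Membership.DecPropositional (≡-dec _≟ℕ_) using (_∈?_)
open import Data.Product using (Σ; ∃; _×_)
open import Relation.Binary.PropositionalEquality using (_≡_; _≢_)
open import Relation.Nullary using (¬_; ¬?)
open import Data.Bool using (if_then_else_)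
open import Algebra.Bundles using (CommutativeRing)

IsPerm : ℕ → List ℕ → Set
IsPerm n w = length w ≡ n × All (λ x → 1 ≤ x × x ≤ n) w × Unique w

_≟L_ = ≡-dec _≟ℕ_

words : ℕ → ℕ → List (List ℕ)
words n zero = [] ∷ []
words n (suc L) = concatMap (λ w → map (_∷ w) (map suc (upTo n))) (words n L)

Sn : ℕ → List (List ℕ)
Sn n = filter (UD.unique? _≟ℕ_) (words n n)

des : List ℕ → ℕ
des [] = 0
des (x ∷ []) = 0
des (x ∷ y ∷ r) = descAt x y N.+ des (y ∷ r)
  where
  descAt : ℕ → ℕ → ℕ
  descAt a b = if b N.<ᵇ a then 1 else 0

inv : List ℕ → ℕ
inv [] = 0
inv (x ∷ r) = length (filter (_<? x) r) N.+ inv r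

red : List ℕ → List ℕ
red w = map (λ x → suc (length (filter (_<? x) w))) w

window : ℕ → ℕ → List ℕ → List ℕ
window p i σ = take p (drop i σ)

-- admissible starting positions (0-based): 0 … n-p  (none if n < p)
positions : ℕ → List ℕ → List ℕ
positions p σ = upTo (suc (length σ) ∸ p)

matchCount : List ℕ → List ℕ → ℕ
matchCount τ σ =
  length (filter (λ i → red (window (length τ) i σ) ≟L τ) (positions (length τ) σ))

NM : ℕ → List (List ℕ) → ℕ → List (List ℕ)
NM p Γ n =
  filter (λ σ → ¬? (any? (λ i → red (window p i σ) ∈? Γ) (positions p σ))) (Sn n)

MinOverlapping : ℕ → List ℕ → Set
MinOverlapping p τ =
  (Σ (List ℕ) λ σ → IsPerm ((2 N.* p) ∸ 1) σ × matchCount τ σ ≡ 2)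
  × (∀ i → i < (2 N.* p) ∸ 1 → ∀ σ → IsPerm i σ → matchCount τ σ ≢ 2)

MutMinOverlapping : ℕ → List ℕ → List ℕ → Set
MutMinOverlapping p α β =
  MinOverlapping p α × MinOverlapping p β
  × (Σ (List ℕ) λ σ → IsPerm ((2 N.* p) ∸ 1) σ × 1 ≤ matchCount α σ × 1 ≤ matchCount β σ)
  × (∀ n → n < (2 N.* p) ∸ 1 → ∀ σ → IsPerm n σ →
       ¬ (1 ≤ matchCount α σ × 1 ≤ matchCount β σ))

StartsWith1 : List ℕ → Set
StartsWith1 α = ∃ λ r → α ≡ 1 ∷ r

Admissible : ℕ → List ℕ → Set
Admissible p α = IsPerm p α × MinOverlapping p α × StartsWith1 α

-- last element (0 for the empty list; never used on empty lists)
lastElem : List ℕ → ℕ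
lastElem = foldl (λ _ x → x) 0

-- Ring-valued quantities, for an arbitrary commutative ring R and
-- elements q z of R (polynomial identities in ℤ[q,z] = identities in all R).
module RingDefs {c ℓ : Level} (R : CommutativeRing c ℓ) where
  open CommutativeRing R

  pow : Carrier → ℕ → Carrier
  pow x zero = 1#
  pow x (suc n) = x * pow x n

  sumR : List Carrier → Carrier
  sumR = foldr _+_ 0#

  -- q-binomial coefficient [m choose k]_q (0 when k > m), via q-Pascal
  qbin : Carrier → ℕ → ℕ → Carrier
  qbin q m zero = 1#
  qbin q zero (suc k) = 0#
  qbin q (suc m) (suc k) = qbin q m k + pow q (suc k) * qbin q m (suc k)

  -- INM_{Γ,n}(q,z), with INM_{Γ,0} = 1 (the constant term of INM_Γ(t,q,z))
  INM : ℕ → List (List ℕ) → Carrier → Carrier → ℕ → Carrier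
  INM p Γ q z zero = 1#
  INM p Γ q z (suc n) =
    sumR (map (λ σ → pow z (suc (des σ)) * pow q (inv σ)) (NM p Γ (suc n)))

  -- coefficient of t^n/[n]_q! in (Σ IU_k t^k/[k]_q!)·INM_Γ(t,q,z)
  convCoeff : ℕ → List (List ℕ) → Carrier → Carrier → (ℕ → Carrier) → ℕ → Carrier
  convCoeff p Γ q z IU n =
    sumR (map (λ k → qbin q n k * IU k * INM p Γ q z (n ∸ k)) (upTo (suc n)))

-- Goulden–Jackson clusters. For a word σ put f(σ) = z^(des σ + 1) if σ has no Γ-match and f(σ) =
-- 0 otherwise (f = 1 on the empty word), and let u(σ) be −z times the total weight of the ways to
-- link all of σ into one chain of ascents, weighted 1 − z each, and of marked Γ-matches, weighted
-- −z^des each and overlapping their neighbours in one letter (u = 1 on the empty word). The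
-- overlap hypotheses say that two Γ-matches of a permutation share at most one letter; peeling
-- off the first link of a chain then shows ∑ u(v) f(w) = 0 over all factorisations σ = v w of a
-- nonempty word. As u and f only depend on relative order, the q^inv-weighted sums U_n of u and
-- N_n of f over S_n satisfy ∑_k [n choose k]_q U_k N_(n-k) = 0, that is, U = IU. Since every α in
-- Γ starts with 1, each link of a chain starts with its minimum and u vanishes unless the first
-- letter is the smallest. Hence an initial ascent contributes (1 − z) U_(n-1). For an initial
-- match of α, ending with s, the s smallest letters all belong to the match; choosing its other p
-- − s letters among the remaining n − s gives the q-binomial.

module Submission where

open import Defs
open import Level using (Level)
import Data.Nat as N
open import Data.Nat hiding (_+_; _*_)
open import Data.Nat.Properties
open import Data.Nat.Induction using (<-rec)
open import Algebra.Properties.CommutativeSemigroup +-commutativeSemigroup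
  using () renaming (interchange to +-interchange)
open import Data.Nat.ListAction using (sum)
open import Data.Nat.ListAction.Properties using (sum-↭)
open import Data.Bool using (true; false)
open import Data.Empty using (⊥-elim)
open import Data.Product using (_×_; _,_; proj₁; proj₂; ∃)
open import Data.Sum using (_⊎_; inj₁; inj₂)
open import Data.List hiding (sum; find)
open import Data.List.Properties
open import Data.List.Relation.Unary.All as All using (All; []; _∷_)
import Data.List.Relation.Unary.All.Properties as All
open import Data.List.Relation.Unary.Any using (Any; here; there; any?)
open import Data.List.Relation.Unary.AllPairs as AllPairs using (AllPairs; []; _∷_)
import Data.List.Relation.Unary.AllPairs.Properties as AllPairs
open import Data.List.Relation.Unary.Unique.Propositional using (Unique)
import Data.List.Relation.Unary.Unique.DecPropositional as UD
open import Data.List.Membership.DecPropositional (≡-dec _≟_) using (_∈?_)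
open import Data.List.Membership.Propositional using (_∈_; find; lose)
open import Data.List.Membership.Propositional.Properties
open import Data.List.Relation.Binary.Permutation.Propositional
  using (_↭_; ↭⇒↭ₛ; ↭-refl; ↭-sym; ↭-trans; prep; swap)
open import Data.List.Relation.Binary.Permutation.Propositional.Properties
  using (∈-resp-↭; ↭-length; shift; filter-↭; map⁺)
open import Relation.Binary.PropositionalEquality hiding ([_])
open import Relation.Binary.Definitions using (tri<; tri≈; tri>)
import Data.List.Relation.Binary.Permutation.Setoid.Properties as SetoidPerm
open import Relation.Nullary
open import Algebra.Bundles using (CommutativeRing)
open import Function using (_∘_; id; case_of_)

-- The identity ∑ u(v) f(w) = 0 is proved in the form C(σ) = -f(σ), where C sums u(v) f(w) over the
-- factorisations of σ with v nonempty. Let σ = x τ with y the first letter of τ. The cut right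
-- after x contributes -z f(τ). If x < y, a first ascent contributes (1 - z) C(τ) = -(1 - z) f(τ),
-- and the two add up to -f(τ). At a descent only -z f(τ) is left, the factor z recording that
-- descent. A match at the front contributes -z^des C(τ′) = z^des f(τ′), where τ′ starts at the last
-- letter of the match. The match begins with an ascent and all further matches lie in τ′, so this
-- is f(τ); everything cancels, in agreement with f(σ) = 0. The factors of a permutation are no
-- permutations themselves. Hence u and f live on all words, and sums run over arrangements of
-- arbitrary increasing lists, relabelled to 1, ..., n at the end. No division by [n]_q! occurs: in
-- the n-th convolution identity IU_n has coefficient 1, so these identities determine IU over any
-- commutative ring.

private variable
  A B : Set

-- Arrangements and splittings of lists

module Words where
  open N using (_+_; _*_)

  iota : ℕ → List ℕ
  iota n = map suc (upTo n)

  Increasing : List ℕ → Set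
  Increasing = AllPairs _<_

  -- Elements are chosen by position, not by value, so `arr` commutes with `map` along any function
  -- (`∑-arr-map`); the relabelling arguments rest on this.
  select : List A → List (A × List A)
  select [] = []
  select (x ∷ xs) = (x , xs) ∷ map (λ (y , ys) → y , x ∷ ys) (select xs)

  arr : ℕ → List A → List (List A)
  arr zero    xs = [] ∷ []
  arr (suc n) xs = concatMap (λ (x , ys) → map (x ∷_) (arr n ys)) (select xs)

  -- The k-element sublists B with their complements C, in a recursion that matches q-Pascal's.
  splits : ℕ → List A → List (List A × List A)
  splits zero    xs = ([] , xs) ∷ []
  splits (suc k) [] = []
  splits (suc k) (x ∷ xs) =
    map (λ (B , C) → x ∷ B , C) (splits k xs) ++ map (λ (B , C) → B , x ∷ C) (splits (suc k) xs)

  select-↭ : {x : A} {xs ys : List A} → (x , ys) ∈ select xs → xs ↭ x ∷ ys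
  select-↭ {xs = a ∷ xs} (here refl) = ↭-refl
  select-↭ {xs = a ∷ xs} (there m) with ∈-map⁻ _ m
  ... | (y , ys) , m′ , refl = ↭-trans (prep a (select-↭ m′)) (swap a y ↭-refl)

  map-proj₁-select : (xs : List A) → map proj₁ (select xs) ≡ xs
  map-proj₁-select [] = refl
  map-proj₁-select (x ∷ xs) =
    cong (x ∷_) (trans (sym (map-∘ (select xs))) (map-proj₁-select xs))

  arr-suc⁻ : ∀ n (xs : List A) {w} → w ∈ arr (suc n) xs →
    ∃ λ x → ∃ λ ys → ∃ λ v → (x , ys) ∈ select xs × v ∈ arr n ys × w ≡ x ∷ v
  arr-suc⁻ n xs m with find (∈-concatMap⁻ _ {xs = select xs} m)
  ... | (x , ys) , s , m′ with ∈-map⁻ (x ∷_) m′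
  ... | v , v∈ , eq = x , ys , v , s , v∈ , eq

  arr-length : ∀ n {xs w : List A} → w ∈ arr n xs → length w ≡ n
  arr-length zero (here refl) = refl
  arr-length (suc n) {xs} m with arr-suc⁻ n xs m
  ... | x , ys , v , s , v∈ , refl = cong suc (arr-length n {ys} v∈)

  arr-↭ : ∀ n {xs w : List A} → length xs ≡ n → w ∈ arr n xs → w ↭ xs
  arr-↭ zero {[]} eq (here refl) = ↭-refl
  arr-↭ (suc n) {xs} eq m with arr-suc⁻ n xs m
  ... | x , ys , v , s , v∈ , refl =
    ↭-trans (prep x (arr-↭ n (suc-injective (trans (sym (↭-length (select-↭ s))) eq)) v∈))
            (↭-sym (select-↭ s))

  splits-suc⁻ : ∀ k {x : A} {xs B C} → (B , C) ∈ splits (suc k) (x ∷ xs) →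
    (∃ λ B′ → (B′ , C) ∈ splits k xs × B ≡ x ∷ B′)
    ⊎ (∃ λ C′ → (B , C′) ∈ splits (suc k) xs × C ≡ x ∷ C′)
  splits-suc⁻ k {x} {xs} m with ∈-++⁻ (map _ (splits k xs)) m
  ... | inj₁ m₁ with ∈-map⁻ _ m₁
  ...   | (B , C) , m′ , refl = inj₁ (B , m′ , refl)
  splits-suc⁻ k {x} {xs} m | inj₂ m₂ with ∈-map⁻ _ m₂
  ...   | (B , C) , m′ , refl = inj₂ (C , m′ , refl)

  splits-↭ : ∀ k {xs B C : List A} → (B , C) ∈ splits k xs → B ++ C ↭ xs
  splits-↭ zero (here refl) = ↭-refl
  splits-↭ (suc k) {x ∷ xs} {B} m with splits-suc⁻ k m
  ... | inj₁ (B′ , m′ , refl) = prep x (splits-↭ k m′)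
  ... | inj₂ (C′ , m′ , refl) = ↭-trans (shift x B C′) (prep x (splits-↭ (suc k) m′))

  splits-lengthˡ : ∀ k {xs B C : List A} → (B , C) ∈ splits k xs → length B ≡ k
  splits-lengthˡ zero (here refl) = refl
  splits-lengthˡ (suc k) {x ∷ xs} m with splits-suc⁻ k m
  ... | inj₁ (B′ , m′ , refl) = cong suc (splits-lengthˡ k {xs} m′)
  ... | inj₂ (C′ , m′ , refl) = splits-lengthˡ (suc k) {xs} m′

  splits-lengthʳ : ∀ k {m} {xs B C : List A} → length xs ≡ k + m → (B , C) ∈ splits k xs →
    length C ≡ m
  splits-lengthʳ k {m} {xs} {B} {C} eq s = +-cancelˡ-≡ k (length C) m (begin
    k + length C        ≡⟨ cong (_+ length C) (splits-lengthˡ k {xs} s) ⟨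
    length B + length C ≡⟨ length-++ B ⟨
    length (B ++ C)     ≡⟨ ↭-length (splits-↭ k s) ⟩
    length xs           ≡⟨ eq ⟩
    k + m               ∎)
    where open ≡-Reasoning

  splits-⊆ˡ : ∀ k {xs B C : List A} {x} → (B , C) ∈ splits k xs → x ∈ B → x ∈ xs
  splits-⊆ˡ k s x∈ = ∈-resp-↭ (splits-↭ k s) (∈-++⁺ˡ x∈)

  splits-⊆ʳ : ∀ k {xs B C : List A} {x} → (B , C) ∈ splits k xs → x ∈ C → x ∈ xs
  splits-⊆ʳ k {B = B} s x∈ = ∈-resp-↭ (splits-↭ k s) (∈-++⁺ʳ B x∈)

  splits-increasing : ∀ k {xs B C} → Increasing xs → (B , C) ∈ splits k xs →
    Increasing B × Increasing C
  splits-increasing zero inc (here refl) = [] , inc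
  splits-increasing (suc k) {x ∷ xs} (x< ∷ inc) m with splits-suc⁻ k m
  ... | inj₁ (B′ , m′ , refl) with splits-increasing k inc m′
  ...   | iB , iC = All.tabulate (All.lookup x< ∘ splits-⊆ˡ k m′) ∷ iB , iC
  splits-increasing (suc k) {x ∷ xs} (x< ∷ inc) m | inj₂ (C′ , m′ , refl)
    with splits-increasing (suc k) inc m′
  ...   | iB , iC = iB , All.tabulate (All.lookup x< ∘ splits-⊆ʳ (suc k) m′) ∷ iC

  increasing-iota : ∀ n → Increasing (iota n)
  increasing-iota n = AllPairs.map⁺ (AllPairs.applyUpTo⁺₁ id n (λ i<j _ → s≤s i<j))

  increasing⇒unique : ∀ {xs} → Increasing xs → Unique xs
  increasing⇒unique = AllPairs.map <⇒≢

  unique-iota : ∀ n → Unique (iota n)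
  unique-iota n = increasing⇒unique (increasing-iota n)

  unique-↭ : {xs ys : List A} → xs ↭ ys → Unique xs → Unique ys
  unique-↭ {A = A} xs↭ys = SetoidPerm.Unique-resp-↭ (setoid A) (↭⇒↭ₛ xs↭ys)

  ∈-iota⁻ : ∀ {n x} → x ∈ iota n → ∃ λ i → i < n × x ≡ suc i
  ∈-iota⁻ {n} m with ∈-map⁻ suc m
  ... | i , i∈ , eq = i , ∈-upTo⁻ i∈ , eq

  ∈-iota⁺ : ∀ {n x} → 1 ≤ x → x ≤ n → x ∈ iota n
  ∈-iota⁺ (s≤s _) le = ∈-map⁺ suc (∈-upTo⁺ le)

  length-iota : ∀ n → length (iota n) ≡ n
  length-iota n = trans (length-map suc (upTo n)) (length-applyUpTo id n)

  -- Inversions, descents and ranks under order-preserving relabelling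

  cnt : ℕ → List ℕ → ℕ
  cnt x v = length (filter (_<? x) v)

  cross : List ℕ → List ℕ → ℕ
  cross v w = sum (map (λ x → cnt x w) v)

  cnt-< : ∀ {x y} v → y < x → cnt x (y ∷ v) ≡ suc (cnt x v)
  cnt-< {x} v y<x = cong length (filter-accept (_<? x) y<x)

  cnt-≮ : ∀ {x y} v → ¬ y < x → cnt x (y ∷ v) ≡ cnt x v
  cnt-≮ {x} v y≮x = cong length (filter-reject (_<? x) y≮x)

  cnt-all-≮ : ∀ {x} v → All (x <_) v → cnt x v ≡ 0
  cnt-all-≮ [] [] = refl
  cnt-all-≮ (y ∷ v) (x<y ∷ a) = trans (cnt-≮ v (<-asym x<y)) (cnt-all-≮ v a)

  cnt-++ : ∀ x v w → cnt x (v ++ w) ≡ cnt x v + cnt x w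
  cnt-++ x v w = trans (cong length (filter-++ (_<? x) v w)) (length-++ (filter (_<? x) v))

  cnt-↭ : ∀ x {v w} → v ↭ w → cnt x v ≡ cnt x w
  cnt-↭ x v↭w = ↭-length (filter-↭ (_<? x) v↭w)

  -- Inversions across a cut depend only on which letters stand on either side, so their power of q
  -- can be taken out of the sums over arrangements of the two sides.
  cross-↭ : ∀ {v v′ w w′} → v ↭ v′ → w ↭ w′ → cross v w ≡ cross v′ w′
  cross-↭ {v} {v′} {w} {w′} pv pw =
    trans (cong sum (map-cong (λ x → cnt-↭ x pw) v)) (sum-↭ (map⁺ (λ x → cnt x w′) pv))

  -- Each letter of `v` forms one inversion with `a`. This produces the factor `pow q (suc k)` of
  -- q-Pascal.
  cross-∷ʳ : ∀ a v w → All (a <_) v → cross v (a ∷ w) ≡ length v + cross v w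
  cross-∷ʳ a [] w [] = refl
  cross-∷ʳ a (x ∷ v) w (a<x ∷ a<) = begin
    cnt x (a ∷ w) + cross v (a ∷ w)       ≡⟨ cong₂ _+_ (cnt-< w a<x) (cross-∷ʳ a v w a<) ⟩
    suc (cnt x w) + (length v + cross v w) ≡⟨ cong suc (+-assoc (cnt x w) (length v) _) ⟨
    suc (cnt x w + length v + cross v w)   ≡⟨ cong (λ n → suc (n + cross v w)) (+-comm (cnt x w) _) ⟩
    suc (length v + cnt x w + cross v w)   ≡⟨ cong suc (+-assoc (length v) _ _) ⟩
    suc (length v + (cnt x w + cross v w)) ∎
    where open ≡-Reasoning

  inv-++ : ∀ v w → inv (v ++ w) ≡ cross v w + (inv v + inv w)
  inv-++ [] w = refl
  inv-++ (x ∷ v) w = begin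
    cnt x (v ++ w) + inv (v ++ w)
      ≡⟨ cong₂ _+_ (trans (cnt-++ x v w) (+-comm (cnt x v) _)) (inv-++ v w) ⟩
    (cnt x w + cnt x v) + (cross v w + (inv v + inv w))
      ≡⟨ +-interchange (cnt x w) (cnt x v) (cross v w) _ ⟩
    (cnt x w + cross v w) + (cnt x v + (inv v + inv w))
      ≡⟨ cong ((cnt x w + cross v w) +_) (+-assoc (cnt x v) (inv v) (inv w)) ⟨
    (cnt x w + cross v w) + (cnt x v + inv v + inv w) ∎
    where open ≡-Reasoning

  -- Monotonicity is asked on the letters of `w` only, because relabellings such as `at xs ∘ pred`
  -- take junk values elsewhere.
  Mono : (ℕ → ℕ) → List ℕ → Set
  Mono φ w = ∀ {x y} → x ∈ w → y ∈ w → x < y → φ x < φ y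

  mono-reflects : ∀ {φ w} → Mono φ w → ∀ {x y} → x ∈ w → y ∈ w → φ x < φ y → x < y
  mono-reflects {φ} mono {x} {y} x∈ y∈ φx<φy with <-cmp x y
  ... | tri< x<y _ _ = x<y
  ... | tri≈ _ refl _ = ⊥-elim (<-irrefl refl φx<φy)
  ... | tri> _ _ y<x = ⊥-elim (<-asym φx<φy (mono y∈ x∈ y<x))

  mono-⊆ : ∀ {φ v w} → (∀ {x} → x ∈ v → x ∈ w) → Mono φ w → Mono φ v
  mono-⊆ sub mono x∈ y∈ = mono (sub x∈) (sub y∈)

  mono-tail : ∀ {φ x w} → Mono φ (x ∷ w) → Mono φ w
  mono-tail = mono-⊆ there

  -- The letter and the list it is compared with only share an ambient word `w`: `inv` compares a
  -- letter with the tail behind it, `red` with the whole word.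
  cnt-map : ∀ {φ w} → Mono φ w → ∀ {x} v → x ∈ w → (∀ {y} → y ∈ v → y ∈ w) →
    cnt (φ x) (map φ v) ≡ cnt x v
  cnt-map mono [] x∈ sub = refl
  cnt-map {φ} mono {x} (y ∷ v) x∈ sub with <-≤-connex y x
  ... | inj₁ y<x = trans (cnt-< (map φ v) (mono (sub (here refl)) x∈ y<x))
                        (trans (cong suc (cnt-map mono v x∈ (sub ∘ there))) (sym (cnt-< v y<x)))
  ... | inj₂ x≤y = trans (cnt-≮ (map φ v) (≤⇒≯ x≤y ∘ mono-reflects mono (sub (here refl)) x∈))
                       (trans (cnt-map mono v x∈ (sub ∘ there)) (sym (cnt-≮ v (≤⇒≯ x≤y))))

  map-cong-∈ : {f g : A → B} (xs : List A) → (∀ {x} → x ∈ xs → f x ≡ g x) → map f xs ≡ map g xs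
  map-cong-∈ [] h = refl
  map-cong-∈ (x ∷ xs) h = cong₂ _∷_ (h (here refl)) (map-cong-∈ xs (h ∘ there))

  red-map : ∀ {φ} w → Mono φ w → red (map φ w) ≡ red w
  red-map w mono =
    trans (sym (map-∘ w)) (map-cong-∈ w (λ x∈ → cong suc (cnt-map mono w x∈ id)))

  inv-map : ∀ {φ} w → Mono φ w → inv (map φ w) ≡ inv w
  inv-map [] mono = refl
  inv-map (x ∷ w) mono = cong₂ _+_ (cnt-map mono w (here refl) there) (inv-map w (mono-tail mono))

  des-< : ∀ {x y} r → x < y → des (x ∷ y ∷ r) ≡ des (y ∷ r)
  -- `des` branches on this Boolean inside a local function; its soundness proof is abstracted along
  -- with it so that the two stay linked.
  des-< {x} {y} r x<y with y <ᵇ x | <ᵇ⇒< y x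
  ... | false | _ = refl
  ... | true  | y<x = ⊥-elim (<-asym x<y (y<x _))

  des-> : ∀ {x y} r → y < x → des (x ∷ y ∷ r) ≡ suc (des (y ∷ r))
  des-> {x} {y} r y<x with y <ᵇ x | <⇒<ᵇ y<x
  ... | true | _ = refl

  des-≮ : ∀ {x y} r → ¬ y < x → des (x ∷ y ∷ r) ≡ des (y ∷ r)
  des-≮ {x} {y} r y≮x with y <ᵇ x | <ᵇ⇒< y x
  ... | false | _ = refl
  ... | true  | y<x = ⊥-elim (y≮x (y<x _))

  des-map : ∀ {φ} w → Mono φ w → des (map φ w) ≡ des w
  des-map [] mono = refl
  des-map (x ∷ []) mono = refl
  des-map {φ} (x ∷ y ∷ r) mono = step (des-map (y ∷ r) (mono-tail mono))
    where
    open ≡-Reasoning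
    step : des (φ y ∷ map φ r) ≡ des (y ∷ r) → des (φ x ∷ φ y ∷ map φ r) ≡ des (x ∷ y ∷ r)
    step ih with <-≤-connex y x
    ... | inj₁ y<x = begin
      des (φ x ∷ φ y ∷ map φ r) ≡⟨ des-> (map φ r) (mono (there (here refl)) (here refl) y<x) ⟩
      suc (des (φ y ∷ map φ r)) ≡⟨ cong suc ih ⟩
      suc (des (y ∷ r))         ≡⟨ des-> r y<x ⟨
      des (x ∷ y ∷ r)           ∎
    ... | inj₂ x≤y = begin
      des (φ x ∷ φ y ∷ map φ r)
        ≡⟨ des-≮ (map φ r) (≤⇒≯ x≤y ∘ mono-reflects mono (there (here refl)) (here refl)) ⟩
      des (φ y ∷ map φ r) ≡⟨ ih ⟩
      des (y ∷ r)         ≡⟨ des-≮ r (≤⇒≯ x≤y) ⟨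
      des (x ∷ y ∷ r)     ∎

  -- The two pieces share one letter, so every adjacent pair lies in exactly one of them.
  des-take-drop : ∀ k w → suc k ≤ length w → des w ≡ des (take (suc k) w) + des (drop k w)
  des-take-drop zero (x ∷ w) le = refl
  des-take-drop (suc k) (x ∷ y ∷ r) (s≤s le) with <-≤-connex y x
  ... | inj₁ y<x = begin
    des (x ∷ y ∷ r)       ≡⟨ des-> r y<x ⟩
    suc (des (y ∷ r))     ≡⟨ cong suc (des-take-drop k (y ∷ r) le) ⟩
    suc (des (take (suc k) (y ∷ r))) + des (drop k (y ∷ r))
      ≡⟨ cong (_+ des (drop k (y ∷ r))) (des-> (take k r) y<x) ⟨
    des (x ∷ y ∷ take k r) + des (drop k (y ∷ r)) ∎
    where open ≡-Reasoning
  ... | inj₂ x≤y = begin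
    des (x ∷ y ∷ r)       ≡⟨ des-≮ r (≤⇒≯ x≤y) ⟩
    des (y ∷ r)           ≡⟨ des-take-drop k (y ∷ r) le ⟩
    des (take (suc k) (y ∷ r)) + des (drop k (y ∷ r))
      ≡⟨ cong (_+ des (drop k (y ∷ r))) (des-≮ (take k r) (≤⇒≯ x≤y)) ⟨
    des (x ∷ y ∷ take k r) + des (drop k (y ∷ r)) ∎
    where open ≡-Reasoning

  -- 0-based, with junk value 0 past the end.
  at : List ℕ → ℕ → ℕ
  at []       i       = 0
  at (x ∷ xs) zero    = x
  at (x ∷ xs) (suc i) = at xs i

  at-∈ : ∀ xs {i} → i < length xs → at xs i ∈ xs
  at-∈ (x ∷ xs) {zero}  le       = here refl
  at-∈ (x ∷ xs) {suc i} (s≤s le) = there (at-∈ xs le)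

  at-mono : ∀ {xs} → Increasing xs → ∀ {i j} → j < length xs → i < j → at xs i < at xs j
  at-mono {x ∷ xs} (x< ∷ inc) {zero}  {suc j} (s≤s le) i<j       = All.lookup x< (at-∈ xs le)
  at-mono {x ∷ xs} (x< ∷ inc) {suc i} {suc j} (s≤s le) (s≤s i<j) = at-mono inc le i<j

  map-at-upTo : ∀ xs → map (at xs) (upTo (length xs)) ≡ xs
  map-at-upTo xs = trans (map-upTo (at xs) (length xs)) (go xs)
    where
    go : ∀ xs → applyUpTo (at xs) (length xs) ≡ xs
    go [] = refl
    go (x ∷ xs) = cong (x ∷_) (go xs)

  map-at-iota : ∀ xs → map (at xs ∘ pred) (iota (length xs)) ≡ xs
  map-at-iota xs = trans (sym (map-∘ (upTo (length xs)))) (map-at-upTo xs)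

  mono-at : ∀ {xs w} → Increasing xs → w ↭ iota (length xs) → Mono (at xs ∘ pred) w
  mono-at inc w↭ x∈ y∈ x<y with ∈-iota⁻ (∈-resp-↭ w↭ x∈) | ∈-iota⁻ (∈-resp-↭ w↭ y∈)
  mono-at inc w↭ x∈ y∈ (s≤s i<j) | i , _ , refl | j , j< , refl = at-mono inc j< i<j

  cnt-iota : ∀ {j n} → j ≤ n → cnt (suc j) (iota n) ≡ j
  cnt-iota {j} {n} j≤n = trans (shifted j n) (go j≤n)
    where
    shifted : ∀ j n → cnt (suc j) (iota n) ≡ cnt j (upTo n)
    shifted j n = cnt-map {w = j ∷ upTo n} (λ _ _ → s≤s) (upTo n) (here refl) there
    go : ∀ {j n} → j ≤ n → cnt j (upTo n) ≡ j
    go {zero} {n} z≤n = cnt-all-0 (upTo n)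
      where
      cnt-all-0 : ∀ v → cnt 0 v ≡ 0
      cnt-all-0 [] = refl
      cnt-all-0 (y ∷ v) = trans (cnt-≮ {y = y} v n≮0) (cnt-all-0 v)
    go {suc j} {suc n} (s≤s j≤n) = begin
      cnt (suc j) (0 ∷ applyUpTo suc n)   ≡⟨ cnt-< (applyUpTo suc n) z<s ⟩
      suc (cnt (suc j) (applyUpTo suc n)) ≡⟨ cong (suc ∘ cnt (suc j)) (map-upTo suc n) ⟨
      suc (cnt (suc j) (iota n))          ≡⟨ cong suc (shifted j n) ⟩
      suc (cnt j (upTo n))                ≡⟨ cong suc (go j≤n) ⟩
      suc j                               ∎
      where open ≡-Reasoning

  red-perm : ∀ {n w} → w ↭ iota n → red w ≡ w
  red-perm {n} {w} w↭ = trans (map-cong-∈ w rank) (map-id w)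
    where
    rank : ∀ {x} → x ∈ w → suc (cnt x w) ≡ x
    rank x∈ with ∈-iota⁻ (∈-resp-↭ w↭ x∈)
    ... | i , i<n , refl = cong suc (trans (cnt-↭ (suc i) w↭) (cnt-iota (<⇒≤ i<n)))

  drop-lastElem : ∀ k w → suc k ≤ length w →
    drop k w ≡ lastElem (take (suc k) w) ∷ drop (suc k) w
  drop-lastElem zero    (x ∷ w)     le       = refl
  drop-lastElem (suc k) (x ∷ y ∷ w) (s≤s le) = drop-lastElem k (y ∷ w) le

  lastElem-∈ : ∀ x w → lastElem (x ∷ w) ∈ x ∷ w
  lastElem-∈ x []      = here refl
  lastElem-∈ x (y ∷ w) = there (lastElem-∈ y w)

  lastElem-map : ∀ (φ : ℕ → ℕ) x w → lastElem (map φ (x ∷ w)) ≡ φ (lastElem (x ∷ w))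
  lastElem-map φ x []      = refl
  lastElem-map φ x (y ∷ w) = lastElem-map φ y w

  ∈-take : ∀ {x : A} k w → x ∈ take k w → x ∈ w
  ∈-take k w x∈ = subst (_ ∈_) (take++drop≡id k w) (∈-++⁺ˡ x∈)

  ∈-drop : ∀ {x : A} k w → x ∈ drop k w → x ∈ w
  ∈-drop k w x∈ = subst (_ ∈_) (take++drop≡id k w) (∈-++⁺ʳ (take k w) x∈)

  length-red : ∀ w → length (red w) ≡ length w
  length-red w = length-map _ w

  -- Rank 1 at the head means that the list of smaller letters is empty.
  red-head-min : ∀ {x w r y} → red (x ∷ w) ≡ 1 ∷ r → y ∈ x ∷ w → ¬ y < x
  red-head-min {x} {w} eq y∈ y<x with filter (_<? x) (x ∷ w) in eq′
  ... | [] with subst (_ ∈_) eq′ (∈-filter⁺ (_<? x) y∈ y<x)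
  ...   | ()
  red-head-min {x} {w} eq y∈ y<x | z ∷ zs with ∷-injectiveˡ eq
  ...   | ()
  cnt-≤ : ∀ {x y} v → x ≤ y → cnt x v ≤ cnt y v
  cnt-≤ [] x≤y = z≤n
  cnt-≤ {x} {y} (z ∷ v) x≤y with <-≤-connex z x
  ... | inj₁ z<x = subst₂ _≤_ (sym (cnt-< v z<x)) (sym (cnt-< v (<-≤-trans z<x x≤y))) (s≤s (cnt-≤ v x≤y))
  ... | inj₂ x≤z = ≤-trans (≤-reflexive (cnt-≮ v (≤⇒≯ x≤z)))
    (≤-trans (cnt-≤ v x≤y) (subst (cnt y v ≤_) (sym (cnt-++ y (z ∷ []) v)) (m≤n+m _ _)))

  cnt-strict : ∀ {x y} v → x ∈ v → x < y → cnt x v < cnt y v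
  cnt-strict (z ∷ v) (here refl) x<y =
    subst₂ _<_ (sym (cnt-≮ v (<-irrefl refl))) (sym (cnt-< v x<y)) (s≤s (cnt-≤ v (<⇒≤ x<y)))
  cnt-strict {x} {y} (z ∷ v) (there x∈) x<y with <-≤-connex z x
  ... | inj₁ z<x =
    subst₂ _<_ (sym (cnt-< v z<x)) (sym (cnt-< v (<-trans z<x x<y))) (s≤s (cnt-strict v x∈ x<y))
  ... | inj₂ x≤z = ≤-trans (s≤s (≤-reflexive (cnt-≮ v (≤⇒≯ x≤z))))
    (≤-trans (cnt-strict v x∈ x<y) (subst (cnt y v ≤_) (sym (cnt-++ y (z ∷ []) v)) (m≤n+m _ _)))

  unique-map-∈ : {f : A → B} (xs : List A) → (∀ {x y} → x ∈ xs → y ∈ xs → f x ≡ f y → x ≡ y) →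
    Unique xs → Unique (map f xs)
  unique-map-∈ [] inj [] = []
  unique-map-∈ (x ∷ xs) inj (x∉ ∷ u) =
    All.map⁺ (All.tabulate (λ y∈ eq → All.lookup x∉ y∈ (inj (here refl) (there y∈) eq)))
    ∷ unique-map-∈ xs (λ x∈ y∈ → inj (there x∈) (there y∈)) u

  -- `red w` maps this rank function over `w`: standardisation is itself an order-preserving
  -- relabelling, and the results on `Mono` apply to it.
  mono-rank : ∀ w → Mono (λ x → suc (cnt x w)) w
  mono-rank w x∈ _ x<y = s≤s (cnt-strict w x∈ x<y)

  mono⇒injective : ∀ {φ w} → Mono φ w → ∀ {x y} → x ∈ w → y ∈ w → φ x ≡ φ y → x ≡ y
  mono⇒injective mono {x} {y} x∈ y∈ eq with <-cmp x y
  ... | tri< x<y _ _ = ⊥-elim (<-irrefl eq (mono x∈ y∈ x<y))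
  ... | tri≈ _ x≡y _ = x≡y
  ... | tri> _ _ y<x = ⊥-elim (<-irrefl (sym eq) (mono y∈ x∈ y<x))

  red-isPerm : ∀ {w} → Unique w → IsPerm (length w) (red w)
  red-isPerm {w} u =
    length-red w ,
    -- The letter `x` is not counted below itself, which keeps its rank at most `length w`.
    All.map⁺ (All.tabulate λ {x} x∈ → s≤s z≤n , filter-notAll (_<? x) w (lose x∈ (<-irrefl refl))) ,
    unique-map-∈ w (mono⇒injective (mono-rank w)) u

  window-map : ∀ (φ : ℕ → ℕ) p i w → window p i (map φ w) ≡ map φ (window p i w)
  window-map φ p i w = trans (cong (take p) (drop-map i w)) (take-map p (drop i w))

  red-window-map : ∀ {φ} p i w → Mono φ w → red (window p i (map φ w)) ≡ red (window p i w)
  red-window-map {φ} p i w mono =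
    trans (cong red (window-map φ p i w))
          (red-map (window p i w) (mono-⊆ (∈-drop i w ∘ ∈-take p (drop i w)) mono))

  red-window-red : ∀ p i w → red (window p i (red w)) ≡ red (window p i w)
  red-window-red p i w = red-window-map p i w (mono-rank w)

  window-take : ∀ {p i j} (σ : List ℕ) → j ≤ i → window p j (take (i + p) σ) ≡ window p j σ
  window-take {p} {i} {j} σ j≤i = begin
    take p (drop j (take (i + p) σ))       ≡⟨ take-drop p j (take (i + p) σ) ⟩
    drop j (take (j + p) (take (i + p) σ)) ≡⟨ cong (drop j) (take-take (j + p) (i + p) σ) ⟩
    drop j (take ((j + p) ⊓ (i + p)) σ)
      ≡⟨ cong (λ k → drop j (take k σ)) (m≤n⇒m⊓n≡m (+-monoˡ-≤ p j≤i)) ⟩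
    drop j (take (j + p) σ)                ≡⟨ take-drop p j σ ⟨
    take p (drop j σ)                      ∎
    where open ≡-Reasoning

  length-window⁻ : ∀ {p} i (σ : List ℕ) → 1 ≤ p → length (window p i σ) ≡ p → i + p ≤ length σ
  length-window⁻ {suc p} zero σ _ eq = m⊓n≡m⇒m≤n (trans (sym (length-take (suc p) σ)) eq)
  length-window⁻ {suc p} (suc i) [] _ ()
  length-window⁻ {suc p} (suc i) (x ∷ σ) 1≤p eq = s≤s (length-window⁻ i σ 1≤p eq)

  length-take-≤ : ∀ k (w : List A) → k ≤ length w → length (take k w) ≡ k
  length-take-≤ k w le = trans (length-take k w) (m≤n⇒m⊓n≡m le)

  -- Yields the count of exactly two that `MinOverlapping` forbids for short permutations.
  filter-head-last : {P : ℕ → Set} (P? : ∀ n → Dec (P n)) → ∀ {i} → P 0 → P (suc i) →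
    (∀ {j} → 0 < j → j < suc i → ¬ P j) → length (filter P? (upTo (suc (suc i)))) ≡ 2
  filter-head-last P? {i} P0 Pi none = begin
    length (filter P? (0 ∷ applyUpTo suc (suc i)))
      ≡⟨ cong length (filter-accept P? P0) ⟩
    suc (length (filter P? (applyUpTo suc (suc i))))
      ≡⟨ cong (suc ∘ length ∘ filter P?) (applyUpTo-∷ʳ suc i) ⟨
    suc (length (filter P? (applyUpTo suc i ++ suc i ∷ [])))
      ≡⟨ cong (suc ∘ length) (filter-++ P? (applyUpTo suc i) (suc i ∷ [])) ⟩
    suc (length (filter P? (applyUpTo suc i) ++ filter P? (suc i ∷ [])))
      ≡⟨ cong suc (cong₂ (λ xs ys → length (xs ++ ys))
           (filter-none P? (All.applyUpTo⁺₁ suc i (λ j<i → none z<s (s≤s j<i)))) (filter-accept P? Pi)) ⟩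
    2 ∎
    where open ≡-Reasoning

  allPairs-lookup : {R : A → A → Set} {xs : List A} → AllPairs R xs → ∀ {x y} → x ∈ xs → y ∈ xs →
    x ≡ y ⊎ (R x y ⊎ R y x)
  allPairs-lookup (rs ∷ ps) (here refl) (here refl) = inj₁ refl
  allPairs-lookup (rs ∷ ps) (here refl) (there y∈) = inj₂ (inj₁ (All.lookup rs y∈))
  allPairs-lookup (rs ∷ ps) (there x∈) (here refl) = inj₂ (inj₂ (All.lookup rs x∈))
  allPairs-lookup (rs ∷ ps) (there x∈) (there y∈) = allPairs-lookup ps x∈ y∈

  take-++-length : ∀ k (v w : List A) → length v ≡ k → take k (v ++ w) ≡ v
  take-++-length zero    []      w eq = refl
  take-++-length (suc k) (x ∷ v) w eq = cong (x ∷_) (take-++-length k v w (suc-injective eq))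

  drop-++-length : ∀ k (v w : List A) → length v ≡ k → drop k (v ++ w) ≡ w
  drop-++-length zero    []      w eq = refl
  drop-++-length (suc k) (x ∷ v) w eq = drop-++-length k v w (suc-injective eq)

  splits-∷ʳ : ∀ k {x : A} {xs B C} → (B , C) ∈ splits (suc k) xs → (B , x ∷ C) ∈ splits (suc k) (x ∷ xs)
  splits-∷ʳ k {x} {xs} s =
    ∈-++⁺ʳ (map (λ (B , C) → x ∷ B , C) (splits k xs)) (∈-map⁺ (λ (B , C) → B , x ∷ C) s)

open Words

-- Occurrences of patterns and their overlaps

module Matching (d : ℕ) (Γ : List (List ℕ))
  (admissible : All (Admissible (suc (suc d))) Γ)
  (mutual-minimal : AllPairs (MutMinOverlapping (suc (suc d))) Γ) where

  open N using (_+_; _*_)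

  -- With p written as d + 2, a match on `x ∷ w` ends at the first letter of `drop d w`, the letter
  -- that the next link shares.
  p : ℕ
  p = suc (suc d)

  -- No bound on `i` is built in: a window running past the end is too short to reduce to an element
  -- of Γ (`fits`).
  Occurs : ℕ → List ℕ → Set
  Occurs i σ = red (window p i σ) ∈ Γ

  occurs? : ∀ i σ → Dec (Occurs i σ)
  occurs? i σ = red (window p i σ) ∈? Γ

  Match : List ℕ → Set
  Match σ = Any (λ i → Occurs i σ) (positions p σ)

  match? : ∀ σ → Dec (Match σ)
  match? σ = any? (λ i → occurs? i σ) (positions p σ)

  length-Γ : ∀ {α} → α ∈ Γ → length α ≡ p
  length-Γ α∈ = proj₁ (proj₁ (All.lookup admissible α∈))

  fits : ∀ {α} i σ → length α ≡ p → red (window p i σ) ≡ α → i + p ≤ length σ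
  fits i σ len eq =
    length-window⁻ i σ (s≤s z≤n) (trans (sym (length-red (window p i σ))) (trans (cong length eq) len))

  ∈-positions : ∀ {i} σ → i + p ≤ length σ → i ∈ positions p σ
  ∈-positions {i} σ le = ∈-upTo⁺ (m+n≤o⇒m≤o∸n (suc i) (s≤s le))

  occurs⇒match : ∀ {i} σ → Occurs i σ → Match σ
  occurs⇒match {i} σ o = lose (∈-positions σ (fits i σ (length-Γ o) refl)) o

  match⇒occurs : ∀ {σ} → Match σ → ∃ λ i → Occurs i σ
  match⇒occurs m with find m
  ... | i , _ , o = i , o

  matchCount-length : ∀ {α} σ → length α ≡ p →
    matchCount α σ ≡ length (filter (λ i → red (window p i σ) ≟L α) (positions p σ))
  matchCount-length {α} σ len =
    cong (λ n → length (filter (λ i → red (window n i σ) ≟L α) (positions n σ))) len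

  1≤matchCount : ∀ {α} i σ → length α ≡ p → red (window p i σ) ≡ α → 1 ≤ matchCount α σ
  1≤matchCount {α} i σ len eq = subst (1 ≤_) (sym (matchCount-length σ len))
    (∈-length (∈-filter⁺ (λ i → red (window p i σ) ≟L α) (∈-positions σ (fits i σ len eq)) eq))

  -- The part of `σ` up to the end of an occurrence at `i`, standardised so that the overlap
  -- hypotheses, which speak of permutations, apply to it.
  prefix : ℕ → List ℕ → List ℕ
  prefix i σ = red (take (i + p) σ)

  prefix-window : ∀ i j σ → j ≤ i → red (window p j (prefix i σ)) ≡ red (window p j σ)
  prefix-window i j σ j≤i =
    trans (red-window-red p j (take (i + p) σ)) (cong red (window-take σ j≤i))

  prefix-isPerm : ∀ i {σ} → i + p ≤ length σ → Unique σ → IsPerm (i + p) (prefix i σ)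
  prefix-isPerm i {σ} le u =
    subst (λ n → IsPerm n (prefix i σ)) (length-take-≤ (i + p) σ le)
      (red-isPerm (AllPairs.take⁺ (i + p) u))

  prefix-short : ∀ {i} → i < suc d → i + p < 2 * p ∸ 1
  -- `2 * p ∸ 1` computes to `suc d + (p + 0)`.
  prefix-short i<p = +-mono-<-≤ i<p (m≤m+n p 0)

  -- Two occurrences of α at distance less than p − 1, with none in between, would give a
  -- permutation of length less than 2p − 1 with exactly two α-matches.
  no-self-overlap : ∀ {α} σ → α ∈ Γ → Unique σ → red (take p σ) ≡ α →
    ∀ i → 0 < i → i < suc d → red (window p i σ) ≢ α
  no-self-overlap {α} σ α∈ u at0 i 0<i i<p = <-rec _ step i 0<i i<p
    where
    len : length α ≡ p
    len = length-Γ α∈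
    step : ∀ i → (∀ {j} → j < i → 0 < j → j < suc d → red (window p j σ) ≢ α) →
      0 < i → i < suc d → red (window p i σ) ≢ α
    step (suc i) before 0<i i<p ati =
      proj₂ (proj₁ (proj₂ (All.lookup admissible α∈))) (suc i + p) (prefix-short i<p) τ
        perm
        (begin
          matchCount α τ ≡⟨ matchCount-length τ len ⟩
          length (filter P? (upTo (suc (length τ) ∸ p)))
            ≡⟨ cong (λ n → length (filter P? (upTo (suc n ∸ p)))) (proj₁ perm) ⟩
          length (filter P? (upTo (suc (suc i) + p ∸ p)))
            ≡⟨ cong (length ∘ filter P? ∘ upTo) (m+n∸n≡m (suc (suc i)) p) ⟩
          length (filter P? (upTo (suc (suc i))))
            ≡⟨ filter-head-last P? (trans (prefix-window (suc i) 0 σ z≤n) at0)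
                 (trans (prefix-window (suc i) (suc i) σ ≤-refl) ati)
                 (λ 0<j j<i eq → before j<i 0<j (<-trans j<i i<p)
                   (trans (sym (prefix-window (suc i) _ σ (<⇒≤ j<i))) eq)) ⟩
          2 ∎)
      where
      open ≡-Reasoning
      τ : List ℕ
      τ = prefix (suc i) σ
      perm : IsPerm (suc i + p) τ
      perm = prefix-isPerm (suc i) (fits (suc i) σ len ati) u
      P? : ∀ j → Dec (red (window p j τ) ≡ α)
      P? j = red (window p j τ) ≟L α

  -- Two equal patterns are kept apart by minimal overlapping, two different ones by mutual minimal
  -- overlapping; the latter is recorded in list order, so either pattern may come first.
  occurrences-apart : ∀ {i} σ → Unique σ → Occurs 0 σ → Occurs i σ → 0 < i → suc d ≤ i
  occurrences-apart {i} σ u o₀ oᵢ 0<i with <-≤-connex i (suc d)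
  ... | inj₂ le = le
  ... | inj₁ i<p = ⊥-elim (absurd (allPairs-lookup mutual-minimal o₀ oᵢ))
    where
    τ : List ℕ
    τ = prefix i σ
    perm : IsPerm (i + p) τ
    perm = prefix-isPerm i (fits i σ (length-Γ oᵢ) refl) u
    count₀ : 1 ≤ matchCount (red (take p σ)) τ
    count₀ = 1≤matchCount 0 τ (length-Γ o₀) (prefix-window i 0 σ z≤n)
    countᵢ : 1 ≤ matchCount (red (window p i σ)) τ
    countᵢ = 1≤matchCount i τ (length-Γ oᵢ) (prefix-window i i σ ≤-refl)
    absurd : _ ⊎ (_ ⊎ _) → _
    absurd (inj₁ eq) = no-self-overlap σ o₀ u refl i 0<i i<p (sym eq)
    absurd (inj₂ (inj₁ (_ , _ , _ , none))) = none _ (prefix-short i<p) τ perm (count₀ , countᵢ)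
    absurd (inj₂ (inj₂ (_ , _ , _ , none))) = none _ (prefix-short i<p) τ perm (countᵢ , count₀)

  head-min : ∀ {x w y} → Occurs 0 (x ∷ w) → y ∈ take p (x ∷ w) → x ≤ y
  head-min o y∈ with proj₂ (proj₂ (All.lookup admissible o))
  ... | r , eq = ≮⇒≥ (red-head-min eq y∈)

  match-∷⁻ : ∀ {x w} → Match (x ∷ w) → Occurs 0 (x ∷ w) ⊎ Match w
  match-∷⁻ {x} {w} m with match⇒occurs {x ∷ w} m
  ... | zero  , o = inj₁ o
  ... | suc i , o = inj₂ (occurs⇒match {i} w o)

  match-∷⁺ : ∀ x {w} → Match w → Match (x ∷ w)
  match-∷⁺ x {w} m with match⇒occurs {w} m
  ... | i , o = occurs⇒match {suc i} (x ∷ w) o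

  match-drop⁺ : ∀ k w → Match (drop k w) → Match w
  match-drop⁺ zero w m = m
  match-drop⁺ (suc k) [] m = m
  match-drop⁺ (suc k) (x ∷ w) m = match-∷⁺ x (match-drop⁺ k w m)

  -- After a match at the front, the next one starts at its last letter or later. Position `i` of
  -- `w` is position `suc i` of `x ∷ w`, so distance at least `suc d` becomes `d ≤ i`.
  match-drop⁻ : ∀ {x w} → Unique (x ∷ w) → Occurs 0 (x ∷ w) → Match w → Match (drop d w)
  match-drop⁻ {x} {w} u o₀ m with match⇒occurs {w} m
  ... | i , o with occurrences-apart (x ∷ w) u o₀ o z<s
  ...   | s≤s d≤i = occurs⇒match {i ∸ d} (drop d w)
    (subst (λ v → red (take p v) ∈ Γ)
      (sym (trans (drop-drop d (i ∸ d) w) (cong (λ j → drop j w) (m+[n∸m]≡n d≤i)))) o)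

-- Finite sums with indicator factors

module Sums {c ℓ : Level} (R : CommutativeRing c ℓ) where
  open N using (_+_; _*_)
  open CommutativeRing R hiding (zero; setoid)
    renaming (_+_ to _⊕_; _*_ to _⊗_; -_ to ⊖_; refl to ≈-refl; sym to ≈-sym; trans to ≈-trans;
              +-comm to ⊕-comm; +-assoc to ⊕-assoc; +-cong to ⊕-cong; +-congˡ to ⊕-congˡ;
              +-congʳ to ⊕-congʳ; +-identityˡ to ⊕-identityˡ; +-identityʳ to ⊕-identityʳ;
              *-cong to ⊗-cong; *-congˡ to ⊗-congˡ; *-congʳ to ⊗-congʳ; *-comm to ⊗-comm;
              *-assoc to ⊗-assoc; *-identityˡ to ⊗-identityˡ; *-identityʳ to ⊗-identityʳ) public
  open import Algebra.Properties.Ring ring public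
    using (-‿distribˡ-*; -‿distribʳ-*; -‿+-comm; -0#≈0#; +-cancelˡ)
  open import Algebra.Properties.CommutativeSemigroup
    (CommutativeRing.*-commutativeSemigroup R) public
    using () renaming (x∙yz≈y∙xz to ⊗-swapˡ)
  open import Algebra.Properties.CommutativeSemigroup
    (CommutativeRing.+-commutativeSemigroup R) public
    using () renaming (interchange to ⊕-interchange)
  open RingDefs R public
  open import Relation.Binary.Reasoning.Setoid (CommutativeRing.setoid R) public

  ∑ : List A → (A → Carrier) → Carrier
  ∑ xs f = sumR (map f xs)

  -- An Iverson bracket: conditions become factors, so that index sets stay fixed and sums can be
  -- exchanged.
  guard : {P : Set} → Dec P → Carrier → Carrier
  guard (true  because _) x = x
  guard (false because _) x = 0#

  guard-yes : {P : Set} (d : Dec P) {x : Carrier} → P → guard d x ≈ x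
  guard-yes (yes _) p = ≈-refl
  guard-yes (no ¬p) p = ⊥-elim (¬p p)

  guard-no : {P : Set} (d : Dec P) {x : Carrier} → ¬ P → guard d x ≈ 0#
  guard-no (yes p) ¬p = ⊥-elim (¬p p)
  guard-no (no _)  ¬p = ≈-refl

  guard-zero : {P : Set} (d : Dec P) → guard d 0# ≈ 0#
  guard-zero (yes _) = ≈-refl
  guard-zero (no _)  = ≈-refl

  guard-⇔ : {P Q : Set} (d : Dec P) (e : Dec Q) {x : Carrier} → (P → Q) → (Q → P) →
    guard d x ≈ guard e x
  guard-⇔ (yes p) e to from = ≈-sym (guard-yes e (to p))
  guard-⇔ (no ¬p) e to from = ≈-sym (guard-no e (¬p ∘ from))

  guard-cong : {P : Set} (d : Dec P) {x y : Carrier} → (P → x ≈ y) → guard d x ≈ guard d y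
  guard-cong (yes p) eq = eq p
  guard-cong (no _)  eq = ≈-refl

  guard-guard : {P Q S : Set} (d : Dec P) (e : Dec Q) (f : Dec S) {x : Carrier} →
    (P → Q × S) → (Q → S → P) → guard d x ≈ guard e (guard f x)
  guard-guard d (yes q) f to from = guard-⇔ d f (proj₂ ∘ to) (from q)
  guard-guard d (no ¬q) f to from = guard-no d (¬q ∘ proj₁ ∘ to)

  guard-⊗ʳ : {P : Set} (d : Dec P) (a x : Carrier) → a ⊗ guard d x ≈ guard d (a ⊗ x)
  guard-⊗ʳ (yes _) a x = ≈-refl
  guard-⊗ʳ (no _)  a x = zeroʳ a

  guard-⊗ˡ : {P : Set} (d : Dec P) (x a : Carrier) → guard d x ⊗ a ≈ guard d (x ⊗ a)
  guard-⊗ˡ (yes _) x a = ≈-refl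
  guard-⊗ˡ (no _)  x a = zeroˡ a

  ∑-cong : (xs : List A) {f g : A → Carrier} → (∀ {x} → x ∈ xs → f x ≈ g x) → ∑ xs f ≈ ∑ xs g
  ∑-cong []       eq = ≈-refl
  ∑-cong (x ∷ xs) eq = ⊕-cong (eq (here refl)) (∑-cong xs (eq ∘ there))

  ∑-zero : (xs : List A) {f : A → Carrier} → (∀ {x} → x ∈ xs → f x ≈ 0#) → ∑ xs f ≈ 0#
  ∑-zero []       eq = ≈-refl
  ∑-zero (x ∷ xs) eq =
    ≈-trans (⊕-cong (eq (here refl)) (∑-zero xs (eq ∘ there))) (⊕-identityˡ 0#)

  ∑-++ : (xs ys : List A) (f : A → Carrier) → ∑ (xs ++ ys) f ≈ ∑ xs f ⊕ ∑ ys f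
  ∑-++ []       ys f = ≈-sym (⊕-identityˡ _)
  ∑-++ (x ∷ xs) ys f = ≈-trans (⊕-congˡ (∑-++ xs ys f)) (≈-sym (⊕-assoc _ _ _))

  ∑-map : (h : A → B) (xs : List A) (f : B → Carrier) → ∑ (map h xs) f ≈ ∑ xs (f ∘ h)
  ∑-map h xs f = reflexive (cong sumR (sym (map-∘ xs)))

  ∑-concatMap : (h : A → List B) (xs : List A) (f : B → Carrier) →
    ∑ (concatMap h xs) f ≈ ∑ xs (λ x → ∑ (h x) f)
  ∑-concatMap h []       f = ≈-refl
  ∑-concatMap h (x ∷ xs) f = ≈-trans (∑-++ (h x) (concatMap h xs) f) (⊕-congˡ (∑-concatMap h xs f))

  ∑-⊕ : (xs : List A) (f g : A → Carrier) → ∑ xs (λ x → f x ⊕ g x) ≈ ∑ xs f ⊕ ∑ xs g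
  ∑-⊕ []       f g = ≈-sym (⊕-identityˡ 0#)
  ∑-⊕ (x ∷ xs) f g = ≈-trans (⊕-congˡ (∑-⊕ xs f g)) (⊕-interchange _ _ _ _)

  ∑-⊗ˡ : (a : Carrier) (xs : List A) (f : A → Carrier) → ∑ xs (λ x → a ⊗ f x) ≈ a ⊗ ∑ xs f
  ∑-⊗ˡ a []       f = ≈-sym (zeroʳ a)
  ∑-⊗ˡ a (x ∷ xs) f = ≈-trans (⊕-congˡ (∑-⊗ˡ a xs f)) (≈-sym (distribˡ a _ _))

  ∑-⊗ʳ : (a : Carrier) (xs : List A) (f : A → Carrier) → ∑ xs (λ x → f x ⊗ a) ≈ ∑ xs f ⊗ a
  ∑-⊗ʳ a []       f = ≈-sym (zeroˡ a)
  ∑-⊗ʳ a (x ∷ xs) f = ≈-trans (⊕-congˡ (∑-⊗ʳ a xs f)) (≈-sym (distribʳ a _ _))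

  ∑-⊖ : (xs : List A) (f : A → Carrier) → ∑ xs (λ x → ⊖ f x) ≈ ⊖ ∑ xs f
  ∑-⊖ []       f = ≈-sym -0#≈0#
  ∑-⊖ (x ∷ xs) f = ≈-trans (⊕-congˡ (∑-⊖ xs f)) (-‿+-comm _ _)

  ∑-guard : {P : Set} (d : Dec P) (xs : List A) (f : A → Carrier) →
    ∑ xs (λ x → guard d (f x)) ≈ guard d (∑ xs f)
  ∑-guard (yes _) xs f = ≈-refl
  ∑-guard (no _)  xs f = ∑-zero xs (λ _ → ≈-refl)

  ∑-comm : (xs : List A) (ys : List B) (f : A → B → Carrier) →
    ∑ xs (λ x → ∑ ys (f x)) ≈ ∑ ys (λ y → ∑ xs (λ x → f x y))
  ∑-comm []       ys f = ≈-sym (∑-zero ys (λ _ → ≈-refl))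
  ∑-comm (x ∷ xs) ys f = ≈-trans (⊕-congˡ (∑-comm xs ys f)) (≈-sym (∑-⊕ ys (f x) _))

  ∑-filter : {P : A → Set} (P? : ∀ x → Dec (P x)) (xs : List A) (f : A → Carrier) →
    ∑ (filter P? xs) f ≈ ∑ xs (λ x → guard (P? x) (f x))
  ∑-filter P? []       f = ≈-refl
  ∑-filter P? (x ∷ xs) f with P? x
  ... | yes _ = ⊕-congˡ (∑-filter P? xs f)
  ... | no _  = ≈-trans (∑-filter P? xs f) (≈-sym (⊕-identityˡ _))

  ∑-upTo-suc : ∀ n (f : ℕ → Carrier) → ∑ (upTo (suc n)) f ≈ f 0 ⊕ ∑ (upTo n) (f ∘ suc)
  ∑-upTo-suc n f = ⊕-congˡ (≈-trans (reflexive (cong (λ xs → ∑ xs f) (sym (map-upTo suc n))))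
                                    (∑-map suc (upTo n) f))

  ∑-upTo-+ : ∀ k m (f : ℕ → Carrier) →
    ∑ (upTo (k + m)) f ≈ ∑ (upTo k) f ⊕ ∑ (upTo m) (λ i → f (k + i))
  ∑-upTo-+ zero    m f = ≈-sym (⊕-identityˡ _)
  ∑-upTo-+ (suc k) m f = begin
    ∑ (upTo (suc (k + m))) f                    ≈⟨ ∑-upTo-suc (k + m) f ⟩
    f 0 ⊕ ∑ (upTo (k + m)) (f ∘ suc)            ≈⟨ ⊕-congˡ (∑-upTo-+ k m (f ∘ suc)) ⟩
    f 0 ⊕ (∑ (upTo k) (f ∘ suc) ⊕ _)            ≈⟨ ⊕-assoc _ _ _ ⟨
    (f 0 ⊕ ∑ (upTo k) (f ∘ suc)) ⊕ _            ≈⟨ ⊕-congʳ (∑-upTo-suc k f) ⟨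
    ∑ (upTo (suc k)) f ⊕ ∑ (upTo m) (λ i → f (suc k + i)) ∎

  ∑-upTo-last : ∀ n (f : ℕ → Carrier) → ∑ (upTo (suc n)) f ≈ ∑ (upTo n) f ⊕ f n
  ∑-upTo-last n f = ≈-trans (reflexive (cong (λ xs → ∑ xs f) (sym (upTo-∷ʳ n))))
    (≈-trans (∑-++ (upTo n) (n ∷ []) f) (⊕-congˡ (⊕-identityʳ _)))

  ∑-guard-≡ : {_≟′_ : (x y : A) → Dec (x ≡ y)} (xs : List A) {a : A} → Unique xs → a ∈ xs →
    (f : A → Carrier) → ∑ xs (λ x → guard (x ≟′ a) (f x)) ≈ f a
  ∑-guard-≡ {_≟′_ = _≟′_} (x ∷ xs) (x∉ ∷ u) (here refl) f = ≈-trans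
    (⊕-cong (guard-yes (x ≟′ x) refl)
            (∑-zero xs (λ {y} y∈ → guard-no (y ≟′ x) (λ y≡x → All.lookup x∉ y∈ (sym y≡x)))))
    (⊕-identityʳ _)
  ∑-guard-≡ {_≟′_ = _≟′_} (x ∷ xs) {a} (x∉ ∷ u) (there a∈) f = ≈-trans
    (⊕-cong (guard-no (x ≟′ a) (All.lookup x∉ a∈)) (∑-guard-≡ {_≟′_ = _≟′_} xs u a∈ f))
    (⊕-identityˡ _)

  -- Without repetitions, exactly one summand survives when `a` is a member. This is how matches of
  -- Γ are sorted by pattern.
  ∑-guard-∈ : {_≟′_ : (x y : A) → Dec (x ≡ y)} (a : A) (xs : List A) (d : Dec (a ∈ xs)) →
    Unique xs → (x : Carrier) → guard d x ≈ ∑ xs (λ y → guard (a ≟′ y) x)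
  ∑-guard-∈ {_≟′_ = _≟′_} a xs (yes a∈) u x = ≈-sym (≈-trans
    (∑-cong xs (λ {y} _ → guard-⇔ (a ≟′ y) (y ≟′ a) sym sym))
    (∑-guard-≡ {_≟′_ = _≟′_} xs u a∈ (λ _ → x)))
  ∑-guard-∈ {_≟′_ = _≟′_} a xs (no a∉) u x =
    ≈-sym (∑-zero xs (λ {y} y∈ → guard-no (a ≟′ y) (λ { refl → a∉ y∈ })))

  -- Sums over arrangements and splittings

  ∑-arr-suc : ∀ n (xs : List A) (f : List A → Carrier) →
    ∑ (arr (suc n) xs) f ≈ ∑ (select xs) (λ (x , ys) → ∑ (arr n ys) (f ∘ (x ∷_)))
  ∑-arr-suc n xs f = ≈-trans
    (∑-concatMap (λ (x , ys) → map (x ∷_) (arr n ys)) (select xs) f)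
    (∑-cong (select xs) (λ {(x , ys)} _ → ∑-map (x ∷_) (arr n ys) f))

  ∑-select-map : (φ : A → B) (xs : List A) (f : B × List B → Carrier) →
    ∑ (select (map φ xs)) f ≈ ∑ (select xs) (λ (x , ys) → f (φ x , map φ ys))
  ∑-select-map φ []       f = ≈-refl
  ∑-select-map φ (x ∷ xs) f = ⊕-congˡ (begin
    ∑ (map (λ (y , ys) → y , φ x ∷ ys) (select (map φ xs))) f
      ≈⟨ ∑-map _ (select (map φ xs)) f ⟩
    ∑ (select (map φ xs)) (λ (y , ys) → f (y , φ x ∷ ys))
      ≈⟨ ∑-select-map φ xs _ ⟩
    ∑ (select xs) (λ (y , ys) → f (φ y , φ x ∷ map φ ys))
      ≈⟨ ∑-map _ (select xs) _ ⟨
    ∑ (map (λ (y , ys) → y , x ∷ ys) (select xs)) (λ (y , ys) → f (φ y , map φ ys)) ∎)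

  ∑-arr-map : (φ : A → B) → ∀ n (xs : List A) (f : List B → Carrier) →
    ∑ (arr n (map φ xs)) f ≈ ∑ (arr n xs) (f ∘ map φ)
  ∑-arr-map φ zero    xs f = ≈-refl
  ∑-arr-map φ (suc n) xs f = begin
    ∑ (arr (suc n) (map φ xs)) f
      ≈⟨ ∑-arr-suc n (map φ xs) f ⟩
    ∑ (select (map φ xs)) (λ (x , ys) → ∑ (arr n ys) (f ∘ (x ∷_)))
      ≈⟨ ∑-select-map φ xs _ ⟩
    ∑ (select xs) (λ (x , ys) → ∑ (arr n (map φ ys)) (f ∘ (φ x ∷_)))
      ≈⟨ ∑-cong (select xs) (λ {(x , ys)} _ → ∑-arr-map φ n ys _) ⟩
    ∑ (select xs) (λ (x , ys) → ∑ (arr n ys) (f ∘ map φ ∘ (x ∷_)))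
      ≈⟨ ∑-arr-suc n xs (f ∘ map φ) ⟨
    ∑ (arr (suc n) xs) (f ∘ map φ) ∎

  ∑-splits-suc : ∀ k (x : A) xs (f : List A × List A → Carrier) →
    ∑ (splits (suc k) (x ∷ xs)) f ≈
    ∑ (splits k xs) (λ (B , C) → f (x ∷ B , C)) ⊕ ∑ (splits (suc k) xs) (λ (B , C) → f (B , x ∷ C))
  ∑-splits-suc k x xs f = ≈-trans
    (∑-++ (map (λ (B , C) → x ∷ B , C) (splits k xs)) _ f)
    (⊕-cong (∑-map _ (splits k xs) f) (∑-map _ (splits (suc k) xs) f))

  ∑-select-∷ : (x : A) (xs : List A) (f : A × List A → Carrier) →
    ∑ (select (x ∷ xs)) f ≈ f (x , xs) ⊕ ∑ (select xs) (λ (y , ys) → f (y , x ∷ ys))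
  ∑-select-∷ x xs f = ⊕-congˡ (∑-map _ (select xs) f)

  -- Choosing an element and then k others is choosing k + 1 elements and then one of them.
  ∑-select-splits : ∀ k (xs : List A) (f : A → List A → List A → Carrier) →
    ∑ (select xs) (λ (x , ys) → ∑ (splits k ys) (λ (B , C) → f x B C)) ≈
    ∑ (splits (suc k) xs) (λ (B , C) → ∑ (select B) (λ (x , B′) → f x B′ C))
  ∑-select-splits k       []       f = ≈-refl
  ∑-select-splits zero    (a ∷ xs) f = begin
    ∑ (select (a ∷ xs)) (λ (x , ys) → f x [] ys ⊕ 0#)
      ≈⟨ ∑-select-∷ a xs _ ⟩
    (f a [] xs ⊕ 0#) ⊕ ∑ (select xs) (λ (x , ys) → f x [] (a ∷ ys) ⊕ 0#)
      ≈⟨ ⊕-cong (≈-sym (⊕-identityʳ _)) (∑-select-splits zero xs (λ x B C → f x B (a ∷ C))) ⟩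
    ((f a [] xs ⊕ 0#) ⊕ 0#) ⊕
      ∑ (splits 1 xs) (λ (B , C) → ∑ (select B) (λ (x , B′) → f x B′ (a ∷ C)))
      ≈⟨ ∑-splits-suc 0 a xs _ ⟨
    ∑ (splits 1 (a ∷ xs)) (λ (B , C) → ∑ (select B) (λ (x , B′) → f x B′ C)) ∎
  ∑-select-splits (suc k) (a ∷ xs) f = begin
    ∑ (select (a ∷ xs)) (λ (x , ys) → ∑ (splits (suc k) ys) (λ (B , C) → f x B C))
      ≈⟨ ∑-select-∷ a xs _ ⟩
    ∑ S (λ (B , C) → f a B C) ⊕
      ∑ (select xs) (λ (x , ys) → ∑ (splits (suc k) (a ∷ ys)) (λ (B , C) → f x B C))
      ≈⟨ ⊕-congˡ (∑-cong (select xs) (λ {(x , ys)} _ → ∑-splits-suc k a ys _)) ⟩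
    ∑ S (λ (B , C) → f a B C) ⊕
      ∑ (select xs) (λ (x , ys) → ∑ (splits k ys) (λ (B , C) → f x (a ∷ B) C)
                                ⊕ ∑ (splits (suc k) ys) (λ (B , C) → f x B (a ∷ C)))
      ≈⟨ ⊕-congˡ (∑-⊕ (select xs) _ _) ⟩
    ∑ S (λ (B , C) → f a B C) ⊕
      (∑ (select xs) (λ (x , ys) → ∑ (splits k ys) (λ (B , C) → f x (a ∷ B) C)) ⊕
       ∑ (select xs) (λ (x , ys) → ∑ (splits (suc k) ys) (λ (B , C) → f x B (a ∷ C))))
      ≈⟨ ⊕-congˡ (⊕-cong (∑-select-splits k xs (λ x B C → f x (a ∷ B) C))
                         (∑-select-splits (suc k) xs (λ x B C → f x B (a ∷ C)))) ⟩
    ∑ S (λ (B , C) → f a B C) ⊕ (∑ S (λ (B , C) → ∑ (select B) (λ (x , B′) → f x (a ∷ B′) C)) ⊕ T)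
      ≈⟨ ⊕-assoc _ _ _ ⟨
    (∑ S (λ (B , C) → f a B C) ⊕ ∑ S (λ (B , C) → ∑ (select B) (λ (x , B′) → f x (a ∷ B′) C))) ⊕ T
      ≈⟨ ⊕-congʳ (∑-⊕ S _ _) ⟨
    ∑ S (λ (B , C) → f a B C ⊕ ∑ (select B) (λ (x , B′) → f x (a ∷ B′) C)) ⊕ T
      ≈⟨ ⊕-congʳ (∑-cong S (λ {(B , C)} _ → ∑-select-∷ a B _)) ⟨
    ∑ S (λ (B , C) → ∑ (select (a ∷ B)) (λ (x , B′) → f x B′ C)) ⊕ T
      ≈⟨ ∑-splits-suc (suc k) a xs _ ⟨
    ∑ (splits (suc (suc k)) (a ∷ xs)) (λ (B , C) → ∑ (select B) (λ (x , B′) → f x B′ C)) ∎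
    where
    S = splits (suc k) xs
    T = ∑ (splits (suc (suc k)) xs) (λ (B , C) → ∑ (select B) (λ (x , B′) → f x B′ (a ∷ C)))

  -- Arranging `k + m` letters amounts to choosing the letters of the first block and arranging both
  -- blocks. In the induction the first letter is drawn before the split, and `∑-select-splits`
  -- moves the draw into the block.
  ∑-arr-splits : ∀ k m (xs : List A) (f : List A → Carrier) →
    ∑ (arr (k + m) xs) f ≈
    ∑ (splits k xs) (λ (B , C) → ∑ (arr k B) (λ v → ∑ (arr m C) (λ w → f (v ++ w))))
  ∑-arr-splits zero    m xs f = ≈-sym (≈-trans (⊕-identityʳ _) (⊕-identityʳ _))
  ∑-arr-splits (suc k) m xs f = begin
    ∑ (arr (suc k + m) xs) f
      ≈⟨ ∑-arr-suc (k + m) xs f ⟩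
    ∑ (select xs) (λ (x , ys) → ∑ (arr (k + m) ys) (f ∘ (x ∷_)))
      ≈⟨ ∑-cong (select xs) (λ {(x , ys)} _ → ∑-arr-splits k m ys (f ∘ (x ∷_))) ⟩
    ∑ (select xs) (λ (x , ys) → ∑ (splits k ys) (λ (B , C) →
      ∑ (arr k B) (λ v → ∑ (arr m C) (λ w → f (x ∷ v ++ w)))))
      ≈⟨ ∑-select-splits k xs (λ x B C → ∑ (arr k B) (λ v → ∑ (arr m C) (λ w → f (x ∷ v ++ w)))) ⟩
    ∑ (splits (suc k) xs) (λ (B , C) → ∑ (select B) (λ (x , B′) →
      ∑ (arr k B′) (λ v → ∑ (arr m C) (λ w → f (x ∷ v ++ w)))))
      ≈⟨ ∑-cong (splits (suc k) xs) (λ {(B , C)} _ → ∑-arr-suc k B _) ⟨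
    ∑ (splits (suc k) xs) (λ (B , C) → ∑ (arr (suc k) B) (λ v → ∑ (arr m C) (λ w → f (v ++ w)))) ∎

-- The alphabet of `words` is always 1, ..., n; here it is arbitrary, since the induction that
-- isolates duplicate-free words deletes used letters from it.
wordsOver : List ℕ → ℕ → List (List ℕ)
wordsOver xs zero    = [] ∷ []
wordsOver xs (suc n) = concatMap (λ w → map (_∷ w) xs) (wordsOver xs n)

words≡wordsOver : ∀ n m → words n m ≡ wordsOver (iota n) m
words≡wordsOver n zero    = refl
words≡wordsOver n (suc m) = cong (concatMap (λ w → map (_∷ w) (iota n))) (words≡wordsOver n m)

avoids? : ∀ a w → Dec (All (a ≢_) w)
avoids? a = All.all? (λ b → ¬? (a ≟ b))

isPerm⇒⊆iota : ∀ {n w} → IsPerm n w → All (_∈ iota n) w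
isPerm⇒⊆iota (_ , bounds , _) = All.map (λ (1≤x , x≤n) → ∈-iota⁺ 1≤x x≤n) bounds

unique? : ∀ w → Dec (Unique w)
unique? = UD.unique? _≟_

-- From `Sn` to arrangements, and inversion-weighted sums

module PermSums {c ℓ : Level} (R : CommutativeRing c ℓ) where
  open Sums R
  open N using (_+_; _*_)

  ∑-words-suc : ∀ xs n (f : List ℕ → Carrier) →
    ∑ (wordsOver xs (suc n)) f ≈ ∑ (wordsOver xs n) (λ w → ∑ xs (λ b → f (b ∷ w)))
  ∑-words-suc xs n f = ≈-trans (∑-concatMap (λ w → map (_∷ w) xs) (wordsOver xs n) f)
    (∑-cong (wordsOver xs n) (λ {w} _ → ∑-map (_∷ w) xs f))

  ∑-select-≢ : ∀ {a xs ys} → Unique xs → (a , ys) ∈ select xs → (f : ℕ → Carrier) →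
    ∑ xs (λ b → guard (¬? (a ≟ b)) (f b)) ≈ ∑ ys f
  ∑-select-≢ {xs = x ∷ xs} (x∉ ∷ u) (here refl) f = ≈-trans
    (⊕-cong (guard-no (¬? (x ≟ x)) (λ ne → ne refl))
            (∑-cong xs (λ {b} b∈ → guard-yes (¬? (x ≟ b)) (All.lookup x∉ b∈))))
    (⊕-identityˡ _)
  ∑-select-≢ {a} {x ∷ xs} (x∉ ∷ u) (there s) f with ∈-map⁻ _ s
  ... | (_ , ys) , s′ , refl = ⊕-cong
    (guard-yes (¬? (a ≟ x)) (λ a≡x →
      All.lookup x∉ (∈-resp-↭ (↭-sym (select-↭ s′)) (here refl)) (sym a≡x)))
    (∑-select-≢ u s′ f)

  ∑-words-avoiding : ∀ n {a xs ys} → Unique xs → (a , ys) ∈ select xs → (f : List ℕ → Carrier) →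
    ∑ (wordsOver xs n) (λ w → guard (avoids? a w) (f w)) ≈ ∑ (wordsOver ys n) f
  ∑-words-avoiding zero    {a} u s f = ⊕-congʳ (guard-yes (avoids? a []) [])
  ∑-words-avoiding (suc n) {a} {xs} {ys} u s f = begin
    ∑ (wordsOver xs (suc n)) (λ w → guard (avoids? a w) (f w))
      ≈⟨ ∑-words-suc xs n _ ⟩
    ∑ (wordsOver xs n) (λ w → ∑ xs (λ b → guard (avoids? a (b ∷ w)) (f (b ∷ w))))
      ≈⟨ ∑-cong (wordsOver xs n) (λ {w} _ → ∑-cong xs (λ {b} _ →
           guard-guard (avoids? a (b ∷ w)) (avoids? a w) (¬? (a ≟ b))
             (λ { (p ∷ ps) → ps , p }) (λ ps p → p ∷ ps))) ⟩
    ∑ (wordsOver xs n) (λ w → ∑ xs (λ b → guard (avoids? a w) (guard (¬? (a ≟ b)) (f (b ∷ w)))))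
      ≈⟨ ∑-cong (wordsOver xs n) (λ {w} _ → ∑-guard (avoids? a w) xs _) ⟩
    ∑ (wordsOver xs n) (λ w → guard (avoids? a w) (∑ xs (λ b → guard (¬? (a ≟ b)) (f (b ∷ w)))))
      ≈⟨ ∑-words-avoiding n u s _ ⟩
    ∑ (wordsOver ys n) (λ w → ∑ xs (λ b → guard (¬? (a ≟ b)) (f (b ∷ w))))
      ≈⟨ ∑-cong (wordsOver ys n) (λ {w} _ → ∑-select-≢ u s (λ b → f (b ∷ w))) ⟩
    ∑ (wordsOver ys n) (λ w → ∑ ys (λ b → f (b ∷ w)))
      ≈⟨ ∑-words-suc ys n f ⟨
    ∑ (wordsOver ys (suc n)) f ∎

  -- A word is duplicate-free when its tail is and avoids the head. `wordsOver` chooses the head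
  -- innermost, so the sums are exchanged first; for a fixed head the tail then ranges over words on
  -- the remaining letters.
  ∑-words-unique : ∀ n {xs} → Unique xs → (f : List ℕ → Carrier) →
    ∑ (wordsOver xs n) (λ w → guard (unique? w) (f w)) ≈ ∑ (arr n xs) f
  ∑-words-unique zero    u f = ⊕-congʳ (guard-yes (unique? []) [])
  ∑-words-unique (suc n) {xs} u f = begin
    ∑ (wordsOver xs (suc n)) (λ w → guard (unique? w) (f w))
      ≈⟨ ∑-words-suc xs n _ ⟩
    ∑ (wordsOver xs n) (λ w → ∑ xs (λ b → guard (unique? (b ∷ w)) (f (b ∷ w))))
      ≈⟨ ∑-comm (wordsOver xs n) xs _ ⟩
    ∑ xs g
      ≡⟨ cong (λ l → ∑ l g) (map-proj₁-select xs) ⟨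
    ∑ (map proj₁ (select xs)) g
      ≈⟨ ∑-map proj₁ (select xs) g ⟩
    ∑ (select xs) (λ (b , ys) → g b)
      ≈⟨ ∑-cong (select xs) (λ {(b , ys)} s → step b ys s) ⟩
    ∑ (select xs) (λ (b , ys) → ∑ (arr n ys) (f ∘ (b ∷_)))
      ≈⟨ ∑-arr-suc n xs f ⟨
    ∑ (arr (suc n) xs) f ∎
    where
    g : ℕ → Carrier
    g b = ∑ (wordsOver xs n) (λ w → guard (unique? (b ∷ w)) (f (b ∷ w)))
    step : ∀ b ys → (b , ys) ∈ select xs → g b ≈ ∑ (arr n ys) (f ∘ (b ∷_))
    step b ys s = begin
      g b
        ≈⟨ ∑-cong (wordsOver xs n) (λ {w} _ → guard-guard (unique? (b ∷ w)) (avoids? b w) (unique? w)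
             (λ { (p ∷ ps) → p , ps }) _∷_) ⟩
      ∑ (wordsOver xs n) (λ w → guard (avoids? b w) (guard (unique? w) (f (b ∷ w))))
        ≈⟨ ∑-words-avoiding n u s _ ⟩
      ∑ (wordsOver ys n) (λ w → guard (unique? w) (f (b ∷ w)))
        ≈⟨ ∑-words-unique n (AllPairs.tail (unique-↭ (select-↭ s) u)) (f ∘ (b ∷_)) ⟩
      ∑ (arr n ys) (f ∘ (b ∷_)) ∎

  ∑-Sn : ∀ n (f : List ℕ → Carrier) → ∑ (Sn n) f ≈ ∑ (arr n (iota n)) f
  ∑-Sn n f = begin
    ∑ (filter unique? (words n n)) f                           ≈⟨ ∑-filter unique? (words n n) f ⟩
    ∑ (words n n) (λ w → guard (unique? w) (f w))
      ≡⟨ cong (λ l → ∑ l (λ w → guard (unique? w) (f w))) (words≡wordsOver n n) ⟩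
    ∑ (wordsOver (iota n) n) (λ w → guard (unique? w) (f w))   ≈⟨ ∑-words-unique n (unique-iota n) f ⟩
    ∑ (arr n (iota n)) f                                       ∎

  ∑-words-≡ : ∀ {xs} a → Unique xs → All (_∈ xs) a → (f : List ℕ → Carrier) →
    ∑ (wordsOver xs (length a)) (λ w → guard (w ≟L a) (f w)) ≈ f a
  ∑-words-≡ [] u [] f = ⊕-identityʳ _
  ∑-words-≡ {xs} (b ∷ a) u (b∈ ∷ a⊆) f = begin
    ∑ (wordsOver xs (suc (length a))) (λ w → guard (w ≟L (b ∷ a)) (f w))
      ≈⟨ ∑-words-suc xs (length a) _ ⟩
    ∑ ws (λ w → ∑ xs (λ c → guard ((c ∷ w) ≟L (b ∷ a)) (f (c ∷ w))))
      ≈⟨ ∑-cong ws (λ {w} _ → ∑-cong xs (λ {c} _ →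
           guard-guard ((c ∷ w) ≟L (b ∷ a)) (w ≟L a) (c ≟ b)
             (λ eq → ∷-injectiveʳ eq , ∷-injectiveˡ eq) (λ eq₁ eq₂ → cong₂ _∷_ eq₂ eq₁))) ⟩
    ∑ ws (λ w → ∑ xs (λ c → guard (w ≟L a) (guard (c ≟ b) (f (c ∷ w)))))
      ≈⟨ ∑-cong ws (λ {w} _ → ∑-guard (w ≟L a) xs _) ⟩
    ∑ ws (λ w → guard (w ≟L a) (∑ xs (λ c → guard (c ≟ b) (f (c ∷ w)))))
      ≈⟨ ∑-words-≡ a u a⊆ _ ⟩
    ∑ xs (λ c → guard (c ≟ b) (f (c ∷ a)))
      ≈⟨ ∑-guard-≡ {_≟′_ = _≟_} xs u b∈ (λ c → f (c ∷ a)) ⟩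
    f (b ∷ a) ∎
    where ws = wordsOver xs (length a)

  -- The sum is taken back to `wordsOver`, where the alphabet stays fixed and words can be compared
  -- letter by letter.
  ∑-arr-≡ : ∀ {n α} → IsPerm n α → (f : List ℕ → Carrier) →
    ∑ (arr n (iota n)) (λ w → guard (w ≟L α) (f w)) ≈ f α
  ∑-arr-≡ {n} {α} perm@(refl , _ , u) f = begin
    ∑ (arr n (iota n)) (λ w → guard (w ≟L α) (f w))
      ≈⟨ ∑-words-unique n (unique-iota n) _ ⟨
    ∑ (wordsOver (iota n) n) (λ w → guard (unique? w) (guard (w ≟L α) (f w)))
      ≈⟨ ∑-cong (wordsOver (iota n) n) (λ {w} _ → guard-guard (w ≟L α) (unique? w) (w ≟L α)
           (λ eq → subst Unique (sym eq) u , eq) (λ _ eq → eq)) ⟨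
    ∑ (wordsOver (iota n) n) (λ w → guard (w ≟L α) (f w))
      ≈⟨ ∑-words-≡ α (unique-iota n) (isPerm⇒⊆iota perm) f ⟩
    f α ∎

  OrderInvariant : (List ℕ → Carrier) → Set ℓ
  OrderInvariant f = ∀ φ w → Mono φ w → f (map φ w) ≈ f w

  ∑-arr-at : ∀ {xs k} → length xs ≡ k → (f : List ℕ → Carrier) →
    ∑ (arr k xs) f ≈ ∑ (arr k (iota k)) (f ∘ map (at xs ∘ pred))
  ∑-arr-at {xs} {k} refl f = ≈-trans
    (reflexive (cong (λ ys → ∑ (arr k ys) f) (sym (map-at-iota xs))))
    (∑-arr-map (at xs ∘ pred) k (iota k) f)

  mono-arr : ∀ {xs k w} → Increasing xs → length xs ≡ k → w ∈ arr k (iota k) → Mono (at xs ∘ pred) w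
  mono-arr {xs} {k} inc refl w∈ = mono-at inc (arr-↭ k (length-iota k) w∈)

  ∑-arr-invariant : ∀ {xs k} → Increasing xs → length xs ≡ k → {f : List ℕ → Carrier} →
    OrderInvariant f → ∑ (arr k xs) f ≈ ∑ (arr k (iota k)) f
  ∑-arr-invariant {xs} {k} inc len {f} invariant = ≈-trans (∑-arr-at len f)
    (∑-cong (arr k (iota k)) (λ {w} w∈ → invariant _ w (mono-arr inc len w∈)))

  pow-+ : ∀ x m n → pow x (m + n) ≈ pow x m ⊗ pow x n
  pow-+ x zero    n = ≈-sym (⊗-identityˡ _)
  pow-+ x (suc m) n = ≈-trans (⊗-congˡ (pow-+ x m n)) (≈-sym (⊗-assoc _ _ _))

  module _ (q : Carrier) where

    qinv : List ℕ → Carrier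
    qinv w = pow q (inv w)

    qinv-invariant : ∀ {f} → OrderInvariant f → OrderInvariant (λ w → qinv w ⊗ f w)
    qinv-invariant invariant φ w mono =
      ⊗-cong (reflexive (cong (pow q) (inv-map w mono))) (invariant φ w mono)

    cross-∷ˡ : ∀ {a} B C → All (a <_) C → cross (a ∷ B) C ≡ cross B C
    cross-∷ˡ B C a< = cong (_+ cross B C) (cnt-all-≮ C a<)

    -- q-Pascal: the least letter goes to `B` and makes no inversion across, or to `C` and makes one
    -- with each of the `suc k` letters of `B`.
    ∑-splits-cross : ∀ k {xs} → Increasing xs →
      ∑ (splits k xs) (λ (B , C) → pow q (cross B C)) ≈ qbin q (length xs) k
    ∑-splits-cross zero    inc = ⊕-identityʳ 1#
    ∑-splits-cross (suc k) [] = ≈-refl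
    ∑-splits-cross (suc k) {a ∷ xs} (a< ∷ inc) = begin
      ∑ (splits (suc k) (a ∷ xs)) (λ (B , C) → pow q (cross B C))
        ≈⟨ ∑-splits-suc k a xs _ ⟩
      ∑ (splits k xs) (λ (B , C) → pow q (cross (a ∷ B) C)) ⊕
        ∑ (splits (suc k) xs) (λ (B , C) → pow q (cross B (a ∷ C)))
        ≈⟨ ⊕-cong
             (∑-cong (splits k xs) (λ {(B , C)} s → reflexive (cong (pow q)
               (cross-∷ˡ B C (All.tabulate (All.lookup a< ∘ splits-⊆ʳ k s))))))
             (∑-cong (splits (suc k) xs) (λ {(B , C)} s → ≈-trans
               (reflexive (cong (pow q) (trans
                 (cross-∷ʳ a B C (All.tabulate (All.lookup a< ∘ splits-⊆ˡ (suc k) s)))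
                 (cong (_+ cross B C) (splits-lengthˡ (suc k) {xs} s)))))
               (pow-+ q (suc k) (cross B C)))) ⟩
      ∑ (splits k xs) (λ (B , C) → pow q (cross B C)) ⊕
        ∑ (splits (suc k) xs) (λ (B , C) → pow q (suc k) ⊗ pow q (cross B C))
        ≈⟨ ⊕-cong (∑-splits-cross k inc)
             (≈-trans (∑-⊗ˡ (pow q (suc k)) (splits (suc k) xs) _)
                      (⊗-congˡ (∑-splits-cross (suc k) inc))) ⟩
      qbin q (suc (length xs)) (suc k) ∎

    -- The first r + 1 entries of xs must all go to B for entry r of B to lie below all of C,
    -- and they create no inversions across.
    ∑-splits-initial : ∀ k m r {xs} → Increasing xs → length xs ≡ k + m → r < k →
      (X : ℕ → List ℕ → Carrier) (Y : Carrier) →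
      (∀ {b C} → All (b <_) C → Increasing C → length C ≡ m → X b C ≈ Y) →
      (∀ {a b C} → a < b → length (a ∷ C) ≡ m → X b (a ∷ C) ≈ 0#) →
      ∑ (splits k xs) (λ (B , C) → pow q (cross B C) ⊗ X (at B r) C) ≈
      qbin q (length xs ∸ suc r) (k ∸ suc r) ⊗ Y
    ∑-splits-initial (suc k) m r {a ∷ xs} (a< ∷ inc) len (s≤s r≤k) X Y below above = begin
      ∑ (splits (suc k) (a ∷ xs)) (λ (B , C) → pow q (cross B C) ⊗ X (at B r) C)
        ≈⟨ ∑-splits-suc k a xs _ ⟩
      ∑ (splits k xs) (λ (B , C) → pow q (cross (a ∷ B) C) ⊗ X (at (a ∷ B) r) C) ⊕
        ∑ (splits (suc k) xs) (λ (B , C) → pow q (cross B (a ∷ C)) ⊗ X (at B r) (a ∷ C))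
        ≈⟨ ⊕-cong
             (∑-cong (splits k xs) (λ {(B , C)} s → ⊗-congʳ (reflexive (cong (pow q)
               (cross-∷ˡ B C (All.tabulate (All.lookup a< ∘ splits-⊆ʳ k s)))))))
             -- If `a` goes to `C`, entry `r` of `B` exceeds it, and `above` applies with `a` at the
             -- head of `C`.
             (∑-zero (splits (suc k) xs) (λ {(B , C)} s → ≈-trans
               (⊗-congˡ (above (All.lookup a< (splits-⊆ˡ (suc k) s (at-∈ B
                 (subst (r <_) (sym (splits-lengthˡ (suc k) {xs} s)) (s≤s r≤k)))))
                 (splits-lengthʳ (suc k) {xs = a ∷ xs} len (splits-∷ʳ k s))))
               (zeroʳ _))) ⟩
      ∑ (splits k xs) (λ (B , C) → pow q (cross B C) ⊗ X (at (a ∷ B) r) C) ⊕ 0#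
        ≈⟨ ⊕-identityʳ _ ⟩
      ∑ (splits k xs) (λ (B , C) → pow q (cross B C) ⊗ X (at (a ∷ B) r) C)
        ≈⟨ rest r r≤k ⟩
      qbin q (length xs ∸ r) (k ∸ r) ⊗ Y ∎
      where
      rest : ∀ r → r ≤ k →
        ∑ (splits k xs) (λ (B , C) → pow q (cross B C) ⊗ X (at (a ∷ B) r) C) ≈
        qbin q (length xs ∸ r) (k ∸ r) ⊗ Y
      rest zero r≤k = begin
        ∑ (splits k xs) (λ (B , C) → pow q (cross B C) ⊗ X a C)
          ≈⟨ ∑-cong (splits k xs) (λ {(B , C)} s → ⊗-congˡ
               (below (All.tabulate (All.lookup a< ∘ splits-⊆ʳ k s))
                      (proj₂ (splits-increasing k inc s))
                      (splits-lengthʳ k (suc-injective len) s))) ⟩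
        ∑ (splits k xs) (λ (B , C) → pow q (cross B C) ⊗ Y)
          ≈⟨ ∑-⊗ʳ Y (splits k xs) _ ⟩
        ∑ (splits k xs) (λ (B , C) → pow q (cross B C)) ⊗ Y
          ≈⟨ ⊗-congʳ (∑-splits-cross k inc) ⟩
        qbin q (length xs) k ⊗ Y ∎
      -- `at (a ∷ B) (suc r)` is `at B r`: the same claim for the shorter list.
      rest (suc r) r<k = ∑-splits-initial k m r inc (suc-injective len) r<k X Y below above

    -- Inversions of a word split into those across the cut, fixed by `(B , C)`, and those within
    -- the blocks. `f` is no product in general: after a match the weight of the rest depends on the
    -- last letter of the match.
    ∑-arr-shuffle : ∀ k m {xs} → length xs ≡ k + m → (f : List ℕ → List ℕ → Carrier) →
      ∑ (arr (k + m) xs) (λ σ → qinv σ ⊗ f (take k σ) (drop k σ)) ≈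
      ∑ (splits k xs) (λ (B , C) → pow q (cross B C) ⊗
        ∑ (arr k B) (λ v → qinv v ⊗ ∑ (arr m C) (λ w → qinv w ⊗ f v w)))
    ∑-arr-shuffle k m {xs} len f = ≈-trans (∑-arr-splits k m xs _)
      (∑-cong (splits k xs) (λ {(B , C)} s → begin
        ∑ (arr k B) (λ v → ∑ (arr m C) (λ w →
          qinv (v ++ w) ⊗ f (take k (v ++ w)) (drop k (v ++ w))))
          ≈⟨ ∑-cong (arr k B) (λ {v} v∈ → ∑-cong (arr m C) (λ {w} w∈ → term s v∈ w∈)) ⟩
        ∑ (arr k B) (λ v → ∑ (arr m C) (λ w → pow q (cross B C) ⊗ (qinv v ⊗ (qinv w ⊗ f v w))))
          ≈⟨ ∑-cong (arr k B) (λ {v} _ → ≈-trans (∑-⊗ˡ _ (arr m C) _) (⊗-congˡ (∑-⊗ˡ _ (arr m C) _))) ⟩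
        ∑ (arr k B) (λ v → pow q (cross B C) ⊗ (qinv v ⊗ ∑ (arr m C) (λ w → qinv w ⊗ f v w)))
          ≈⟨ ∑-⊗ˡ _ (arr k B) _ ⟩
        pow q (cross B C) ⊗ ∑ (arr k B) (λ v → qinv v ⊗ ∑ (arr m C) (λ w → qinv w ⊗ f v w)) ∎))
      where
      term : ∀ {B C v w} → (B , C) ∈ splits k xs → v ∈ arr k B → w ∈ arr m C →
        qinv (v ++ w) ⊗ f (take k (v ++ w)) (drop k (v ++ w)) ≈
        pow q (cross B C) ⊗ (qinv v ⊗ (qinv w ⊗ f v w))
      term {B} {C} {v} {w} s v∈ w∈ = begin
        qinv (v ++ w) ⊗ f (take k (v ++ w)) (drop k (v ++ w))
          ≈⟨ ⊗-cong (reflexive (cong (pow q) (trans (inv-++ v w) (cong (_+ (inv v + inv w)) (cross-↭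
                 (arr-↭ k (splits-lengthˡ k {xs} s) v∈) (arr-↭ m (splits-lengthʳ k len s) w∈))))))
               (reflexive (cong₂ f (take-++-length k v w (arr-length k v∈))
                                  (drop-++-length k v w (arr-length k v∈)))) ⟩
        pow q (cross B C + (inv v + inv w)) ⊗ f v w
          ≈⟨ ⊗-congʳ (≈-trans (pow-+ q (cross B C) _) (⊗-congˡ (pow-+ q (inv v) (inv w)))) ⟩
        (pow q (cross B C) ⊗ (qinv v ⊗ qinv w)) ⊗ f v w
          ≈⟨ ≈-trans (⊗-assoc _ _ _) (⊗-congˡ (⊗-assoc _ _ _)) ⟩
        pow q (cross B C) ⊗ (qinv v ⊗ (qinv w ⊗ f v w)) ∎

    permSum : (List ℕ → Carrier) → ℕ → Carrier
    permSum f n = ∑ (arr n (iota n)) (λ w → qinv w ⊗ f w)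

    -- The product rule for q-exponential generating functions: order invariance makes the block
    -- sums independent of the chosen letters, and the splittings sum to the q-binomial.
    ∑-arr-product : ∀ k m {f g} → OrderInvariant f → OrderInvariant g →
      permSum (λ σ → f (take k σ) ⊗ g (drop k σ)) (k + m) ≈
      qbin q (k + m) k ⊗ permSum f k ⊗ permSum g m
    ∑-arr-product k m {f} {g} f-inv g-inv = begin
      permSum (λ σ → f (take k σ) ⊗ g (drop k σ)) (k + m)
        ≈⟨ ∑-arr-shuffle k m (length-iota (k + m)) (λ v w → f v ⊗ g w) ⟩
      ∑ S (λ (B , C) → pow q (cross B C) ⊗
        ∑ (arr k B) (λ v → qinv v ⊗ ∑ (arr m C) (λ w → qinv w ⊗ (f v ⊗ g w))))
        ≈⟨ ∑-cong S (λ {(B , C)} s → ⊗-congˡ (term s)) ⟩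
      ∑ S (λ (B , C) → pow q (cross B C) ⊗ (permSum f k ⊗ permSum g m))
        ≈⟨ ∑-⊗ʳ _ S _ ⟩
      ∑ S (λ (B , C) → pow q (cross B C)) ⊗ (permSum f k ⊗ permSum g m)
        ≈⟨ ⊗-congʳ (≈-trans (∑-splits-cross k (increasing-iota (k + m)))
             (reflexive (cong (λ n → qbin q n k) (length-iota (k + m))))) ⟩
      qbin q (k + m) k ⊗ (permSum f k ⊗ permSum g m)
        ≈⟨ ⊗-assoc _ _ _ ⟨
      qbin q (k + m) k ⊗ permSum f k ⊗ permSum g m ∎
      where
      S = splits k (iota (k + m))
      term : ∀ {B C} → (B , C) ∈ S →
        ∑ (arr k B) (λ v → qinv v ⊗ ∑ (arr m C) (λ w → qinv w ⊗ (f v ⊗ g w))) ≈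
        permSum f k ⊗ permSum g m
      term {B} {C} s = begin
        ∑ (arr k B) (λ v → qinv v ⊗ ∑ (arr m C) (λ w → qinv w ⊗ (f v ⊗ g w)))
          ≈⟨ ∑-cong (arr k B) (λ {v} _ → ≈-trans (⊗-congˡ (≈-trans
               (∑-cong (arr m C) (λ {w} _ → ⊗-swapˡ (qinv w) (f v) (g w)))
               (∑-⊗ˡ (f v) (arr m C) _))) (≈-sym (⊗-assoc _ _ _))) ⟩
        ∑ (arr k B) (λ v → (qinv v ⊗ f v) ⊗ ∑ (arr m C) (λ w → qinv w ⊗ g w))
          ≈⟨ ∑-⊗ʳ _ (arr k B) _ ⟩
        ∑ (arr k B) (λ v → qinv v ⊗ f v) ⊗ ∑ (arr m C) (λ w → qinv w ⊗ g w)
          ≈⟨ ⊗-cong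
               (∑-arr-invariant (proj₁ incs) (splits-lengthˡ k {iota (k + m)} s) (qinv-invariant f-inv))
               (∑-arr-invariant (proj₂ incs) (splits-lengthʳ k (length-iota (k + m)) s)
                                (qinv-invariant g-inv)) ⟩
        permSum f k ⊗ permSum g m ∎
        where incs = splits-increasing k (increasing-iota (k + m)) s

-- The chain weight `u` and the match-free weight `f`

module Clusters {c ℓ : Level} (R : CommutativeRing c ℓ) (d : ℕ) (Γ : List (List ℕ))
  (admissible : All (Admissible (suc (suc d))) Γ)
  (mutual-minimal : AllPairs (MutMinOverlapping (suc (suc d))) Γ)
  (q z : CommutativeRing.Carrier R) where

  open Sums R
  open N using (_+_; _*_)
  open PermSums R
  open Matching d Γ admissible mutual-minimal

  -- The default is the value of `u` at the empty word, so `head1-drop` also holds past the end of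
  -- the word.
  head1 : List Carrier → Carrier
  head1 []      = 1#
  head1 (x ∷ _) = x

  -- `vs` lists the values of `u` at the suffixes of `w`, beginning with `w` itself. A single letter
  -- ends the chain and contributes the overall factor -z.
  suffix-step : ℕ → List ℕ → List Carrier → Carrier
  suffix-step x []          vs = ⊖ z
  suffix-step x w@(y ∷ _) vs =
    guard (x <? y) ((1# ⊕ ⊖ z) ⊗ head1 vs) ⊕
    ⊖ guard (occurs? 0 (x ∷ w)) (pow z (des (take p (x ∷ w))) ⊗ head1 (drop d vs))

  suffix-values : List ℕ → List Carrier
  suffix-values []      = 1# ∷ []
  suffix-values (x ∷ w) = suffix-step x w (suffix-values w) ∷ suffix-values w

  -- Computed along with its values on all suffixes because the recursion jumps by p − 1 letters.
  u : List ℕ → Carrier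
  u w = head1 (suffix-values w)

  -- `rise` and `front` sort the chains by their first link, an ascent or a marked match; the sign
  -- of a match is left out of `front`.
  rise : List ℕ → Carrier
  rise (x ∷ y ∷ r) = guard (x <? y) ((1# ⊕ ⊖ z) ⊗ u (y ∷ r))
  rise _           = 0#

  front : List ℕ → Carrier
  front σ = guard (occurs? 0 σ) (pow z (des (take p σ)) ⊗ u (drop (suc d) σ))

  head1-drop : ∀ k w → head1 (drop k (suffix-values w)) ≡ u (drop k w)
  head1-drop zero          w       = refl
  head1-drop (suc zero)    []      = refl
  head1-drop (suc (suc k)) []      = refl
  head1-drop (suc k)       (x ∷ w) = head1-drop k w

  u-∷∷ : ∀ x y r → u (x ∷ y ∷ r) ≈ rise (x ∷ y ∷ r) ⊕ ⊖ front (x ∷ y ∷ r)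
  u-∷∷ x y r = ⊕-congˡ (-‿cong (guard-cong (occurs? 0 (x ∷ y ∷ r))
    (λ _ → ⊗-congˡ (reflexive (head1-drop d (y ∷ r))))))

  f : List ℕ → Carrier
  f []        = 1#
  f σ@(_ ∷ _) = guard (¬? (match? σ)) (pow z (suc (des σ)))

  front-invariant : ∀ φ σ → Mono φ σ → u (map φ (drop (suc d) σ)) ≈ u (drop (suc d) σ) →
    front (map φ σ) ≈ front σ
  front-invariant φ σ mono eq = ≈-trans
    (guard-⇔ (occurs? 0 (map φ σ)) (occurs? 0 σ) (subst (_∈ Γ) same) (subst (_∈ Γ) (sym same)))
    (guard-cong (occurs? 0 σ) (λ _ → ⊗-cong
      (reflexive (cong (pow z) (trans (cong des (take-map p σ))
        (des-map (take p σ) (mono-⊆ (∈-take p σ) mono)))))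
      (≈-trans (reflexive (cong u (drop-map (suc d) σ))) eq)))
    where
    same : red (take p (map φ σ)) ≡ red (take p σ)
    same = red-window-map p 0 σ mono

  -- The recursion jumps to `drop d (y ∷ r)`, which is no structural subterm, hence the induction on
  -- a length bound.
  u-invariant-≤ : ∀ n w → length w ≤ n → ∀ φ → Mono φ w → u (map φ w) ≈ u w
  u-invariant-≤ n       []          le φ mono = ≈-refl
  u-invariant-≤ n       (x ∷ [])    le φ mono = ≈-refl
  u-invariant-≤ (suc n) (x ∷ y ∷ r) (s≤s le) φ mono = begin
    u (φ x ∷ φ y ∷ map φ r)
      ≈⟨ u-∷∷ (φ x) (φ y) (map φ r) ⟩
    rise (φ x ∷ φ y ∷ map φ r) ⊕ ⊖ front (φ x ∷ φ y ∷ map φ r)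
      ≈⟨ ⊕-cong
           (≈-trans
             (guard-⇔ (φ x <? φ y) (x <? y) (mono-reflects mono (here refl) (there (here refl)))
                      (mono (here refl) (there (here refl))))
             (guard-cong (x <? y) (λ _ → ⊗-congˡ (u-invariant-≤ n (y ∷ r) le φ (mono-tail mono)))))
           (-‿cong (front-invariant φ (x ∷ y ∷ r) mono
             (u-invariant-≤ n (drop d (y ∷ r)) shorter φ (mono-⊆ (∈-drop (suc d) (x ∷ y ∷ r)) mono)))) ⟩
    rise (x ∷ y ∷ r) ⊕ ⊖ front (x ∷ y ∷ r)
      ≈⟨ u-∷∷ x y r ⟨
    u (x ∷ y ∷ r) ∎
    where
    shorter : length (drop d (y ∷ r)) ≤ n
    shorter = ≤-trans (≤-trans (≤-reflexive (length-drop d (y ∷ r))) (m∸n≤m _ d)) le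

  u-invariant : OrderInvariant u
  u-invariant φ w = u-invariant-≤ (length w) w ≤-refl φ

  match-map : ∀ {φ} σ → Mono φ σ → (Match (map φ σ) → Match σ) × (Match σ → Match (map φ σ))
  match-map {φ} σ mono = to , from
    where
    to : Match (map φ σ) → Match σ
    to m with match⇒occurs {map φ σ} m
    ... | i , o = occurs⇒match {i} σ (subst (_∈ Γ) (red-window-map p i σ mono) o)
    from : Match σ → Match (map φ σ)
    from m with match⇒occurs {σ} m
    ... | i , o = occurs⇒match {i} (map φ σ) (subst (_∈ Γ) (sym (red-window-map p i σ mono)) o)

  f-invariant : OrderInvariant f
  f-invariant φ []        mono = ≈-refl
  f-invariant φ σ@(x ∷ w) mono with match-map σ mono
  ... | to , from = ≈-trans
    (guard-⇔ (¬? (match? (map φ σ))) (¬? (match? σ)) (_∘ from) (_∘ to))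
    (guard-cong (¬? (match? σ)) (λ _ → reflexive (cong (pow z ∘ suc) (des-map σ mono))))

  Occurs-length : ∀ {σ} → Occurs 0 σ → p ≤ length σ
  Occurs-length {σ} o = fits 0 σ (length-Γ o) refl

  -- A letter below `x` cannot belong to the first link, so it lies behind it; it is then also below
  -- the letter where the next link starts, and induction applies there.
  u-vanishes-≤ : ∀ n x w → length w ≤ n → ∀ {y} → y ∈ w → y < x → u (x ∷ w) ≈ 0#
  u-vanishes-≤ (suc n) x (y ∷ r) (s≤s le) {t} t∈ t<x = begin
    u (x ∷ y ∷ r)
      ≈⟨ u-∷∷ x y r ⟩
    rise (x ∷ y ∷ r) ⊕ ⊖ front (x ∷ y ∷ r)
      ≈⟨ ⊕-cong (rise-zero (<-≤-connex x y) t∈) (-‿cong (front-zero (occurs? 0 (x ∷ y ∷ r)))) ⟩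
    0# ⊕ ⊖ 0#
      ≈⟨ -‿inverseʳ 0# ⟩
    0# ∎
    where
    rise-zero : x < y ⊎ y ≤ x → t ∈ y ∷ r → rise (x ∷ y ∷ r) ≈ 0#
    rise-zero (inj₂ y≤x) _           = guard-no (x <? y) (≤⇒≯ y≤x)
    rise-zero (inj₁ x<y) (here refl) = ⊥-elim (<-asym x<y t<x)
    rise-zero (inj₁ x<y) (there t∈r) = ≈-trans
      (guard-cong (x <? y) (λ _ → ≈-trans
        (⊗-congˡ (u-vanishes-≤ n y r le t∈r (<-trans t<x x<y))) (zeroʳ _)))
      (guard-zero (x <? y))
    front-zero : Dec (Occurs 0 (x ∷ y ∷ r)) → front (x ∷ y ∷ r) ≈ 0#
    front-zero (no ¬o) = guard-no (occurs? 0 (x ∷ y ∷ r)) ¬o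
    front-zero (yes o) = ≈-trans (guard-yes (occurs? 0 σ) o) (≈-trans
      (⊗-congˡ (≈-trans (reflexive (cong u (drop-lastElem (suc d) σ (Occurs-length {σ} o))))
        (u-vanishes-≤ n l (drop p σ) shorter t∈tail (<-≤-trans t<x x≤l)))) (zeroʳ _))
      where
      σ = x ∷ y ∷ r
      l = lastElem (take p σ)
      x≤l : x ≤ l
      x≤l = head-min o (lastElem-∈ x (take (suc d) (y ∷ r)))
      shorter : length (drop p σ) ≤ n
      shorter = ≤-trans (≤-trans (≤-reflexive (length-drop d r)) (m∸n≤m _ d)) le
      -- `x` is the minimum of the match, so a smaller letter occurs only after it.
      t∈tail : t ∈ drop p σ
      t∈tail with ∈-++⁻ (take p σ) (subst (t ∈_) (sym (take++drop≡id p σ)) (there t∈))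
      ... | inj₁ t∈take = ⊥-elim (≤⇒≯ (head-min o t∈take) t<x)
      ... | inj₂ t∈drop = t∈drop

  u-vanishes : ∀ x w {y} → y ∈ w → y < x → u (x ∷ w) ≈ 0#
  u-vanishes x w = u-vanishes-≤ (length w) x w ≤-refl

  -- Cancellation over the factorisations of one word

  occurs-take⁻ : ∀ j {σ} → Occurs 0 (take j σ) → p ≤ j
  occurs-take⁻ j {σ} o = ≤-trans (Occurs-length {take j σ} o)
    (≤-trans (≤-reflexive (length-take j σ)) (m⊓n≤m j _))

  take-take-≤ : ∀ {j} (σ : List ℕ) → p ≤ j → take p (take j σ) ≡ take p σ
  take-take-≤ {j} σ p≤j = trans (take-take p j σ) (cong (λ k → take k σ) (m≤n⇒m⊓n≡m p≤j))

  -- The factorisation with empty left part is left out. It contributes `f σ`, so the cancellation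
  -- reads `cuts σ ≈ ⊖ f σ`, a form suited to induction.
  cuts : List ℕ → Carrier
  cuts σ = ∑ (upTo (length σ)) (λ k → u (take (suc k) σ) ⊗ f (drop (suc k) σ))

  frontCuts : ℕ → List ℕ → Carrier
  frontCuts x w = ∑ (upTo (length w)) (λ k → front (x ∷ take (suc k) w) ⊗ f (drop (suc k) w))

  cuts-∷∷ : ∀ x y r → let w = y ∷ r in
    cuts (x ∷ w) ≈ ⊖ z ⊗ f w ⊕ (guard (x <? y) ((1# ⊕ ⊖ z) ⊗ cuts w) ⊕ ⊖ frontCuts x w)
  -- The term split off has the single letter `x` on the left, where `u` is -z; every other left
  -- part starts with `x` and `y`.
  cuts-∷∷ x y r = ≈-trans (∑-upTo-suc (length w) _) (⊕-congˡ (begin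
    ∑ K (λ k → u (x ∷ take (suc k) w) ⊗ f (drop (suc k) w))
      ≈⟨ ∑-cong K (λ {k} _ → term k) ⟩
    ∑ K (λ k → guard (x <? y) ((1# ⊕ ⊖ z) ⊗ (u (take (suc k) w) ⊗ f (drop (suc k) w))) ⊕
               ⊖ (front (x ∷ take (suc k) w) ⊗ f (drop (suc k) w)))
      ≈⟨ ∑-⊕ K _ _ ⟩
    _ ≈⟨ ⊕-cong (≈-trans (∑-guard (x <? y) K _) (guard-cong (x <? y) (λ _ → ∑-⊗ˡ _ K _))) (∑-⊖ K _) ⟩
    guard (x <? y) ((1# ⊕ ⊖ z) ⊗ cuts w) ⊕ ⊖ frontCuts x w ∎))
    where
    w = y ∷ r
    K = upTo (length w)
    term : ∀ k → u (x ∷ take (suc k) w) ⊗ f (drop (suc k) w) ≈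
      guard (x <? y) ((1# ⊕ ⊖ z) ⊗ (u (take (suc k) w) ⊗ f (drop (suc k) w))) ⊕
      ⊖ (front (x ∷ take (suc k) w) ⊗ f (drop (suc k) w))
    term k = begin
      u (x ∷ take (suc k) w) ⊗ F
        ≈⟨ ⊗-congʳ (u-∷∷ x y (take k r)) ⟩
      (rise (x ∷ take (suc k) w) ⊕ ⊖ front (x ∷ take (suc k) w)) ⊗ F
        ≈⟨ distribʳ F _ _ ⟩
      rise (x ∷ take (suc k) w) ⊗ F ⊕ ⊖ front (x ∷ take (suc k) w) ⊗ F
        ≈⟨ ⊕-cong (≈-trans (guard-⊗ˡ (x <? y) _ F) (guard-cong (x <? y) (λ _ → ⊗-assoc _ _ F)))
                  (≈-sym (-‿distribˡ-* _ F)) ⟩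
      guard (x <? y) ((1# ⊕ ⊖ z) ⊗ (u (take (suc k) w) ⊗ F)) ⊕
        ⊖ (front (x ∷ take (suc k) w) ⊗ F) ∎
      where F = f (drop (suc k) w)

  frontCuts-no : ∀ x w → ¬ Occurs 0 (x ∷ w) → frontCuts x w ≈ 0#
  frontCuts-no x w ¬o = ∑-zero (upTo (length w)) (λ {k} _ → ≈-trans
    (⊗-congʳ (guard-no (occurs? 0 (take (suc (suc k)) (x ∷ w)))
      (λ o → ¬o (subst (λ v → red v ∈ Γ)
        (take-take-≤ (x ∷ w) (occurs-take⁻ (suc (suc k)) {x ∷ w} o)) o))))
    (zeroˡ _))

  -- The left part at index `k` has `k + 2` letters. For `k < d` it cannot hold the match; the
  -- remaining cuts are those of the word that starts at the last letter of the match.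
  frontCuts-yes : ∀ x w → Occurs 0 (x ∷ w) →
    frontCuts x w ≈ pow z (des (take p (x ∷ w))) ⊗ cuts (drop d w)
  frontCuts-yes x w o = begin
    ∑ (upTo (length w)) t
      ≡⟨ cong (λ n → ∑ (upTo n) t) len ⟩
    ∑ (upTo (d + length (drop d w))) t
      ≈⟨ ∑-upTo-+ d (length (drop d w)) t ⟩
    ∑ (upTo d) t ⊕ ∑ K (λ k → t (d + k))
      ≈⟨ ⊕-cong (∑-zero (upTo d) (λ {k} k∈ → ≈-trans
           (⊗-congʳ (guard-no (occurs? 0 (take (suc (suc k)) σ)) (λ o′ →
             <⇒≱ (∈-upTo⁻ k∈) (s≤s⁻¹ (s≤s⁻¹ (occurs-take⁻ (suc (suc k)) {σ} o′))))))
           (zeroˡ _)))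
           (∑-cong K (λ {k} _ → late k)) ⟩
    0# ⊕ ∑ K (λ k → pow z (des (take p σ)) ⊗ (u (take (suc k) (drop d w)) ⊗ f (drop (suc k) (drop d w))))
      ≈⟨ ≈-trans (⊕-identityˡ _) (∑-⊗ˡ _ K _) ⟩
    pow z (des (take p σ)) ⊗ cuts (drop d w) ∎
    where
    σ = x ∷ w
    K = upTo (length (drop d w))
    t : ℕ → Carrier
    t k = front (x ∷ take (suc k) w) ⊗ f (drop (suc k) w)
    len : length w ≡ d + length (drop d w)
    len = sym (trans (cong (d +_) (length-drop d w))
      (m+[n∸m]≡n (≤-trans (n≤1+n d) (s≤s⁻¹ (Occurs-length {σ} o)))))
    late : ∀ k → t (d + k) ≈
      pow z (des (take p σ)) ⊗ (u (take (suc k) (drop d w)) ⊗ f (drop (suc k) (drop d w)))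
    late k = ≈-trans
      (⊗-cong
        (≈-trans (guard-yes (occurs? 0 (take j σ)) (subst (λ v → red v ∈ Γ) (sym same) o))
          (⊗-cong (reflexive (cong (pow z ∘ des) same)) (reflexive (cong u drop-take′))))
        (reflexive (cong f (sym (trans (drop-drop d (suc k) w) (cong (λ i → drop i w) (+-suc d k)))))))
      (⊗-assoc _ _ _)
      where
      j = suc (suc (d + k))
      same : take p (take j σ) ≡ take p σ
      same = take-take-≤ σ (s≤s (s≤s (m≤m+n d k)))
      drop-take′ : drop d (take (suc (d + k)) w) ≡ take (suc k) (drop d w)
      drop-take′ = trans (cong (λ i → drop d (take i w)) (sym (+-suc d k))) (sym (take-drop (suc k) d w))

  f-no-match : ∀ x w → ¬ Occurs 0 (x ∷ w) → f (x ∷ w) ≈ guard (¬? (match? w)) (pow z (suc (des (x ∷ w))))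
  f-no-match x w ¬o = guard-⇔ (¬? (match? (x ∷ w))) (¬? (match? w)) (_∘ match-∷⁺ x)
    (λ ¬m m → case match-∷⁻ m of λ { (inj₁ o) → ¬o o ; (inj₂ m′) → ¬m m′ })

  f-ascent : ∀ x y r → ¬ Occurs 0 (x ∷ y ∷ r) → x < y → f (x ∷ y ∷ r) ≈ f (y ∷ r)
  f-ascent x y r ¬o x<y = ≈-trans (f-no-match x (y ∷ r) ¬o)
    (guard-cong (¬? (match? (y ∷ r))) (λ _ → reflexive (cong (pow z ∘ suc) (des-< r x<y))))

  f-descent : ∀ x y r → ¬ Occurs 0 (x ∷ y ∷ r) → y < x → f (x ∷ y ∷ r) ≈ z ⊗ f (y ∷ r)
  f-descent x y r ¬o y<x = ≈-trans (f-no-match x (y ∷ r) ¬o) (≈-trans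
    (guard-cong (¬? (match? (y ∷ r))) (λ _ → reflexive (cong (pow z ∘ suc) (des-> r y<x))))
    (≈-sym (guard-⊗ʳ (¬? (match? (y ∷ r))) z _)))

  f-occurrence : ∀ x w → Occurs 0 (x ∷ w) → f (x ∷ w) ≈ 0#
  f-occurrence x w o = guard-no (¬? (match? (x ∷ w))) (λ ¬m → ¬m (occurs⇒match {0} (x ∷ w) o))

  occurs⇒ascent : ∀ x y r → Unique (x ∷ y ∷ r) → Occurs 0 (x ∷ y ∷ r) → x < y
  occurs⇒ascent x y r ((x≢y ∷ _) ∷ _) o = ≤∧≢⇒< (head-min o (there (here refl))) x≢y

  -- All matches of `w` lie in `drop d w` by the overlap hypotheses. A match opens with an ascent,
  -- so `w` has as many descents as `x ∷ w`, and these split at the last letter of the match.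
  f-after-occurrence : ∀ x w → Unique (x ∷ w) → Occurs 0 (x ∷ w) →
    f w ≈ pow z (des (take p (x ∷ w))) ⊗ f (drop d w)
  f-after-occurrence x [] un o = ⊥-elim (≤⇒≯ (Occurs-length {x ∷ []} o) (s≤s z<s))
  f-after-occurrence x w@(y ∷ r) un o with drop d w in eq
  ... | [] = ⊥-elim (<-irrefl (sym (trans (sym (length-drop d w)) (cong length eq)))
                              (m<n⇒0<n∸m (s≤s⁻¹ (Occurs-length {x ∷ w} o))))
  ... | y′ ∷ r′ = begin
    f w
      ≈⟨ guard-⇔ (¬? (match? w)) (¬? (match? (y′ ∷ r′)))
           (λ ¬m m → ¬m (match-drop⁺ d w (subst Match (sym eq) m)))
           (λ ¬m m → ¬m (subst Match eq (match-drop⁻ un o m))) ⟩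
    guard (¬? (match? (y′ ∷ r′))) (pow z (suc (des w)))
      ≈⟨ guard-cong (¬? (match? (y′ ∷ r′))) (λ _ →
           ≈-trans (reflexive (cong (pow z) des-split)) (pow-+ z (des (take p (x ∷ w))) _)) ⟩
    guard (¬? (match? (y′ ∷ r′))) (pow z (des (take p (x ∷ w))) ⊗ pow z (suc (des (y′ ∷ r′))))
      ≈⟨ guard-⊗ʳ (¬? (match? (y′ ∷ r′))) _ _ ⟨
    pow z (des (take p (x ∷ w))) ⊗ f (y′ ∷ r′) ∎
    where
    des-split : suc (des w) ≡ des (take p (x ∷ w)) + suc (des (y′ ∷ r′))
    des-split = trans (cong suc (trans (sym (des-< r (occurs⇒ascent x y r un o)))
      (trans (des-take-drop (suc d) (x ∷ w) (Occurs-length {x ∷ w} o))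
             (cong (λ v → des (take p (x ∷ w)) + des v) eq)))) (sym (+-suc _ _))

  f-singleton : ∀ x → f (x ∷ []) ≈ z
  f-singleton x = ≈-trans
    (guard-yes (¬? (match? (x ∷ []))) (λ m → case match⇒occurs {x ∷ []} m of λ { (i , o) →
      ≤⇒≯ (≤-trans (m≤n+m p i) (fits i (x ∷ []) (length-Γ o) refl)) (s≤s z<s) }))
    (⊗-identityʳ z)

  -- The origin of the weight 1 - z of an ascent: it completes the -z of the cut after the first
  -- letter, as an ascent in front changes no descent count.
  absorb : ∀ F → ⊖ z ⊗ F ⊕ (1# ⊕ ⊖ z) ⊗ ⊖ F ≈ ⊖ F
  absorb F = begin
    ⊖ z ⊗ F ⊕ (1# ⊕ ⊖ z) ⊗ ⊖ F
      ≈⟨ ⊕-congˡ (distribʳ (⊖ F) 1# (⊖ z)) ⟩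
    ⊖ z ⊗ F ⊕ (1# ⊗ ⊖ F ⊕ ⊖ z ⊗ ⊖ F)
      ≈⟨ ⊕-congˡ (⊕-cong (⊗-identityˡ _) (≈-sym (-‿distribʳ-* (⊖ z) F))) ⟩
    ⊖ z ⊗ F ⊕ (⊖ F ⊕ ⊖ (⊖ z ⊗ F))
      ≈⟨ ⊕-congˡ (⊕-comm _ _) ⟩
    ⊖ z ⊗ F ⊕ (⊖ (⊖ z ⊗ F) ⊕ ⊖ F)
      ≈⟨ ⊕-assoc _ _ _ ⟨
    (⊖ z ⊗ F ⊕ ⊖ (⊖ z ⊗ F)) ⊕ ⊖ F
      ≈⟨ ⊕-congʳ (-‿inverseʳ _) ⟩
    0# ⊕ ⊖ F
      ≈⟨ ⊕-identityˡ _ ⟩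
    ⊖ F ∎

  cuts≈-f-≤ : ∀ n x w → length w ≤ n → Unique (x ∷ w) → cuts (x ∷ w) ≈ ⊖ f (x ∷ w)
  cuts≈-f-≤ n x [] le un =
    ≈-trans (⊕-identityʳ _) (≈-trans (⊗-identityʳ _) (-‿cong (≈-sym (f-singleton x))))
  cuts≈-f-≤ (suc n) x w@(y ∷ r) (s≤s le) un@((x≢y ∷ _) ∷ un′) with occurs? 0 (x ∷ w)
  ... | yes o = begin
    cuts (x ∷ w)
      ≈⟨ cuts-∷∷ x y r ⟩
    ⊖ z ⊗ f w ⊕ (guard (x <? y) ((1# ⊕ ⊖ z) ⊗ cuts w) ⊕ ⊖ frontCuts x w)
      ≈⟨ ⊕-congˡ (⊕-cong
           (≈-trans (guard-yes (x <? y) (occurs⇒ascent x y r un o))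
                    (⊗-congˡ (cuts≈-f-≤ n y r le un′)))
           (-‿cong (≈-trans (frontCuts-yes x w o) jump))) ⟩
    ⊖ z ⊗ f w ⊕ ((1# ⊕ ⊖ z) ⊗ ⊖ f w ⊕ ⊖ ⊖ f w)
      ≈⟨ ⊕-assoc _ _ _ ⟨
    (⊖ z ⊗ f w ⊕ (1# ⊕ ⊖ z) ⊗ ⊖ f w) ⊕ ⊖ ⊖ f w
      ≈⟨ ⊕-congʳ (absorb (f w)) ⟩
    ⊖ f w ⊕ ⊖ ⊖ f w
      ≈⟨ -‿inverseʳ _ ⟩
    0#
      ≈⟨ -0#≈0# ⟨
    ⊖ 0#
      ≈⟨ -‿cong (f-occurrence x w o) ⟨
    ⊖ f (x ∷ w) ∎
    where
    -- The induction hypothesis speaks of nonempty words; `drop d w` is one, as it still contains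
    -- the last letter of the match.
    drop-cuts : ∀ v → length v ≤ suc n → 1 ≤ length v → Unique v → cuts v ≈ ⊖ f v
    drop-cuts (a ∷ v) (s≤s le) _ un = cuts≈-f-≤ n a v le un
    jump : pow z (des (take p (x ∷ w))) ⊗ cuts (drop d w) ≈ ⊖ f w
    jump = begin
      pow z (des (take p (x ∷ w))) ⊗ cuts (drop d w)
        ≈⟨ ⊗-congˡ (drop-cuts (drop d w)
             (≤-trans (≤-trans (≤-reflexive (length-drop d w)) (m∸n≤m _ d)) (s≤s le))
             (≤-trans (m<n⇒0<n∸m (s≤s⁻¹ (Occurs-length {x ∷ w} o)))
                      (≤-reflexive (sym (length-drop d w))))
             (AllPairs.drop⁺ d un′)) ⟩
      pow z (des (take p (x ∷ w))) ⊗ ⊖ f (drop d w)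
        ≈⟨ -‿distribʳ-* _ _ ⟨
      ⊖ (pow z (des (take p (x ∷ w))) ⊗ f (drop d w))
        ≈⟨ -‿cong (f-after-occurrence x w un o) ⟨
      ⊖ f w ∎
  ... | no ¬o = begin
    cuts (x ∷ w)
      ≈⟨ cuts-∷∷ x y r ⟩
    ⊖ z ⊗ f w ⊕ (guard (x <? y) ((1# ⊕ ⊖ z) ⊗ cuts w) ⊕ ⊖ frontCuts x w)
      ≈⟨ ⊕-congˡ (⊕-congˡ (≈-trans (-‿cong (frontCuts-no x w ¬o)) -0#≈0#)) ⟩
    ⊖ z ⊗ f w ⊕ (guard (x <? y) ((1# ⊕ ⊖ z) ⊗ cuts w) ⊕ 0#)
      ≈⟨ ⊕-congˡ (⊕-identityʳ _) ⟩
    ⊖ z ⊗ f w ⊕ guard (x <? y) ((1# ⊕ ⊖ z) ⊗ cuts w)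
      ≈⟨ split ⟩
    ⊖ f (x ∷ w) ∎
    where
    split : ⊖ z ⊗ f w ⊕ guard (x <? y) ((1# ⊕ ⊖ z) ⊗ cuts w) ≈ ⊖ f (x ∷ w)
    split with <-≤-connex x y
    ... | inj₁ x<y = ≈-trans
      (⊕-congˡ (≈-trans (guard-yes (x <? y) x<y) (⊗-congˡ (cuts≈-f-≤ n y r le un′))))
      (≈-trans (absorb (f w)) (-‿cong (≈-sym (f-ascent x y r ¬o x<y))))
    ... | inj₂ y≤x = begin
      ⊖ z ⊗ f w ⊕ guard (x <? y) ((1# ⊕ ⊖ z) ⊗ cuts w) ≈⟨ ⊕-congˡ (guard-no (x <? y) (≤⇒≯ y≤x)) ⟩
      ⊖ z ⊗ f w ⊕ 0#                                    ≈⟨ ⊕-identityʳ _ ⟩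
      ⊖ z ⊗ f w                                         ≈⟨ -‿distribˡ-* z (f w) ⟨
      ⊖ (z ⊗ f w)
        ≈⟨ -‿cong (f-descent x y r ¬o (≤∧≢⇒< y≤x (x≢y ∘ sym))) ⟨
      ⊖ f (x ∷ w)                                       ∎

  cuts≈-f : ∀ x w → Unique (x ∷ w) → cuts (x ∷ w) ≈ ⊖ f (x ∷ w)
  cuts≈-f x w = cuts≈-f-≤ (length w) x w ≤-refl

  -- From words to the convolution identity

  U : ℕ → Carrier
  U = permSum q u

  N : ℕ → Carrier
  N = permSum q f

  INM≈N : ∀ n → INM p Γ q z n ≈ N n
  INM≈N zero    = ≈-sym (≈-trans (⊕-identityʳ _) (⊗-identityʳ _))
  INM≈N (suc n) = begin
    ∑ (NM p Γ (suc n)) (λ σ → pow z (suc (des σ)) ⊗ qinv q σ)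
      ≈⟨ ∑-filter (λ σ → ¬? (match? σ)) (Sn (suc n)) _ ⟩
    ∑ (Sn (suc n)) (λ σ → guard (¬? (match? σ)) (pow z (suc (des σ)) ⊗ qinv q σ))
      ≈⟨ ∑-Sn (suc n) _ ⟩
    ∑ (arr (suc n) (iota (suc n))) (λ σ → guard (¬? (match? σ)) (pow z (suc (des σ)) ⊗ qinv q σ))
      ≈⟨ ∑-cong (arr (suc n) (iota (suc n))) (λ {σ} σ∈ → term σ (arr-length (suc n) {iota (suc n)} σ∈)) ⟩
    N (suc n) ∎
    where
    term : ∀ σ → length σ ≡ suc n →
      guard (¬? (match? σ)) (pow z (suc (des σ)) ⊗ qinv q σ) ≈ qinv q σ ⊗ f σ
    term (x ∷ w) _ = ≈-trans (≈-sym (guard-⊗ˡ (¬? (match? (x ∷ w))) _ _)) (⊗-comm _ _)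

  convolution : ∀ n → 1 ≤ n → convCoeff p Γ q z U n ≈ 0#
  convolution n 1≤n = begin
    ∑ K (λ k → qbin q n k ⊗ U k ⊗ INM p Γ q z (n ∸ k))
      ≈⟨ ∑-cong K (λ {k} _ → ⊗-congˡ (INM≈N (n ∸ k))) ⟩
    ∑ K (λ k → qbin q n k ⊗ U k ⊗ N (n ∸ k))
      ≈⟨ ∑-cong K (λ {k} k∈ → ≈-sym (factor k (s≤s⁻¹ (∈-upTo⁻ k∈)))) ⟩
    ∑ K (λ k → ∑ P (λ σ → qinv q σ ⊗ (u (take k σ) ⊗ f (drop k σ))))
      -- After the exchange the sum over cut positions vanishes for each permutation separately.
      ≈⟨ ∑-comm K P _ ⟩
    ∑ P (λ σ → ∑ K (λ k → qinv q σ ⊗ (u (take k σ) ⊗ f (drop k σ))))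
      ≈⟨ ∑-zero P (λ {σ} σ∈ → ≈-trans (∑-⊗ˡ (qinv q σ) K _) (≈-trans
           (⊗-congˡ (cancel σ (arr-length n {iota n} σ∈)
             (unique-↭ (↭-sym (arr-↭ n (length-iota n) σ∈)) (unique-iota n)))) (zeroʳ _))) ⟩
    0# ∎
    where
    K = upTo (suc n)
    P = arr n (iota n)
    factor : ∀ k → k ≤ n → permSum q (λ σ → u (take k σ) ⊗ f (drop k σ)) n ≈ qbin q n k ⊗ U k ⊗ N (n ∸ k)
    factor k k≤n = subst
      (λ j → permSum q (λ σ → u (take k σ) ⊗ f (drop k σ)) j ≈ qbin q j k ⊗ U k ⊗ N (n ∸ k))
      (m+[n∸m]≡n k≤n) (∑-arr-product q k (n ∸ k) u-invariant f-invariant)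
    cancel : ∀ σ → length σ ≡ n → Unique σ → ∑ K (λ k → u (take k σ) ⊗ f (drop k σ)) ≈ 0#
    cancel []      refl _  = ⊥-elim (<-irrefl refl 1≤n)
    cancel (x ∷ w) refl un = begin
      ∑ (upTo (suc (suc (length w)))) (λ k → u (take k (x ∷ w)) ⊗ f (drop k (x ∷ w)))
        ≈⟨ ∑-upTo-suc (suc (length w)) _ ⟩
      1# ⊗ f (x ∷ w) ⊕ cuts (x ∷ w)
        ≈⟨ ⊕-cong (⊗-identityˡ _) (cuts≈-f x w un) ⟩
      f (x ∷ w) ⊕ ⊖ f (x ∷ w)
        ≈⟨ -‿inverseʳ _ ⟩
      0# ∎

  -- The recurrence for `U`

  -- Used in both directions: to fix the leading 1 in `rise-sum`, and to let the fixed letter `b`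
  -- move freely in `extend-below`.
  ∑-arr-min : ∀ n {a xs} → length xs ≡ n → All (a <_) xs → (g : List ℕ → Carrier) →
    (∀ x w → a ∈ w → a < x → g (x ∷ w) ≈ 0#) →
    ∑ (arr (suc n) (a ∷ xs)) g ≈ ∑ (arr n xs) (g ∘ (a ∷_))
  ∑-arr-min n {a} {xs} len a< g vanish = begin
    ∑ (arr (suc n) (a ∷ xs)) g
      ≈⟨ ∑-arr-suc n (a ∷ xs) g ⟩
    ∑ (select (a ∷ xs)) (λ (x , ys) → ∑ (arr n ys) (g ∘ (x ∷_)))
      ≈⟨ ∑-select-∷ a xs _ ⟩
    ∑ (arr n xs) (g ∘ (a ∷_)) ⊕ ∑ (select xs) (λ (x , ys) → ∑ (arr n (a ∷ ys)) (g ∘ (x ∷_)))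
      ≈⟨ ⊕-congˡ (∑-zero (select xs) (λ {(x , ys)} s → ∑-zero (arr n (a ∷ ys)) (λ {w} w∈ →
           vanish x w
             (∈-resp-↭ (↭-sym (arr-↭ n (trans (sym (↭-length (select-↭ s))) len) w∈)) (here refl))
             (All.lookup a< (∈-resp-↭ (↭-sym (select-↭ s)) (here refl)))))) ⟩
    ∑ (arr n xs) (g ∘ (a ∷_)) ⊕ 0#
      ≈⟨ ⊕-identityʳ _ ⟩
    ∑ (arr n xs) (g ∘ (a ∷_)) ∎

  qinv-min : ∀ {a w} → All (a <_) w → qinv q (a ∷ w) ≈ qinv q w
  qinv-min {a} {w} a< = reflexive (cong (λ i → pow q (i + inv w)) (cnt-all-≮ w a<))

  arr-all : ∀ {P : ℕ → Set} {n xs w} → length xs ≡ n → All P xs → w ∈ arr n xs → All P w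
  arr-all {n = n} len ps w∈ = All.tabulate (All.lookup ps ∘ ∈-resp-↭ (arr-↭ n len w∈))

  U-1 : U 1 ≈ ⊖ z
  U-1 = ≈-trans (⊕-identityʳ _) (⊗-identityˡ _)

  -- If 1 is not first, it is second and spoils the ascent, or comes later and makes `u` vanish on
  -- the tail. A leading 1 creates no inversions.
  rise-sum : ∀ n → permSum q rise (suc (suc n)) ≈ (1# ⊕ ⊖ z) ⊗ U (suc n)
  rise-sum n with increasing-iota (suc (suc n))
  ... | 1< ∷ inc = begin
    ∑ (arr (suc (suc n)) (1 ∷ xs)) (λ w → qinv q w ⊗ rise w)
      ≈⟨ ∑-arr-min (suc n) len 1< _ (λ x w 1∈ 1<x → ≈-trans (⊗-congˡ (vanish x w 1∈ 1<x)) (zeroʳ _)) ⟩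
    ∑ (arr (suc n) xs) (λ w → qinv q (1 ∷ w) ⊗ rise (1 ∷ w))
      ≈⟨ ∑-cong (arr (suc n) xs) (λ {w} w∈ →
           term w (arr-length (suc n) {xs} w∈) (arr-all len 1< w∈)) ⟩
    ∑ (arr (suc n) xs) (λ w → (1# ⊕ ⊖ z) ⊗ (qinv q w ⊗ u w))
      ≈⟨ ∑-⊗ˡ _ (arr (suc n) xs) _ ⟩
    (1# ⊕ ⊖ z) ⊗ ∑ (arr (suc n) xs) (λ w → qinv q w ⊗ u w)
      ≈⟨ ⊗-congˡ (∑-arr-invariant inc len (qinv-invariant q u-invariant)) ⟩
    (1# ⊕ ⊖ z) ⊗ U (suc n) ∎
    where
    xs : List ℕ
    -- The tail of `iota (suc (suc n))` in the form to which it unfolds.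
    xs = map suc (applyUpTo suc (suc n))
    len : length xs ≡ suc n
    len = suc-injective (length-iota (suc (suc n)))
    vanish : ∀ x w → 1 ∈ w → 1 < x → rise (x ∷ w) ≈ 0#
    vanish x (y ∷ w) (here refl) 1<x = guard-no (x <? y) (<-asym 1<x)
    vanish x (y ∷ w) (there 1∈)  1<x with <-≤-connex x y
    ... | inj₂ y≤x = guard-no (x <? y) (≤⇒≯ y≤x)
    ... | inj₁ x<y = ≈-trans
      (guard-cong (x <? y) (λ _ → ≈-trans (⊗-congˡ (u-vanishes y w 1∈ (<-trans 1<x x<y))) (zeroʳ _)))
      (guard-zero (x <? y))
    term : ∀ w → length w ≡ suc n → All (1 <_) w →
      qinv q (1 ∷ w) ⊗ rise (1 ∷ w) ≈ (1# ⊕ ⊖ z) ⊗ (qinv q w ⊗ u w)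
    term (y ∷ r) _ a@(1<y ∷ _) = ≈-trans
      (⊗-cong (qinv-min a) (guard-yes (1 <? y) 1<y)) (⊗-swapˡ _ _ _)

  U-suc : ∀ n → U (suc (suc n)) ≈ (1# ⊕ ⊖ z) ⊗ U (suc n) ⊕ ⊖ permSum q front (suc (suc n))
  U-suc n = begin
    ∑ P (λ w → qinv q w ⊗ u w)
      ≈⟨ ∑-cong P (λ {w} w∈ → term w (arr-length (suc (suc n)) {iota (suc (suc n))} w∈)) ⟩
    ∑ P (λ w → qinv q w ⊗ rise w ⊕ ⊖ (qinv q w ⊗ front w))
      ≈⟨ ∑-⊕ P _ _ ⟩
    permSum q rise (suc (suc n)) ⊕ ∑ P (λ w → ⊖ (qinv q w ⊗ front w))
      ≈⟨ ⊕-cong (rise-sum n) (∑-⊖ P _) ⟩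
    (1# ⊕ ⊖ z) ⊗ U (suc n) ⊕ ⊖ permSum q front (suc (suc n)) ∎
    where
    P = arr (suc (suc n)) (iota (suc (suc n)))
    term : ∀ w → length w ≡ suc (suc n) → qinv q w ⊗ u w ≈ qinv q w ⊗ rise w ⊕ ⊖ (qinv q w ⊗ front w)
    term w@(x ∷ y ∷ r) _ = ≈-trans (⊗-congˡ (u-∷∷ x y r)) (≈-trans (distribˡ (qinv q w) _ _)
      (⊕-congˡ (≈-sym (-‿distribʳ-* (qinv q w) _))))

  front-sum-short : ∀ n → n < p → permSum q front n ≈ 0#
  front-sum-short n n<p = ∑-zero (arr n (iota n)) (λ {σ} σ∈ → ≈-trans
    (⊗-congˡ (guard-no (occurs? 0 σ) (λ o → <⇒≱ n<p
      (≤-trans (Occurs-length {σ} o) (≤-reflexive (arr-length n {iota n} σ∈))))))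
    (zeroʳ _))

  -- The weight of all continuations of a match that ends with `b`: the chain goes on from `b`, but
  -- the inversions of `b` are counted with the match.
  extend : ℕ → ℕ → List ℕ → Carrier
  extend m b C = ∑ (arr m C) (λ w → qinv q w ⊗ u (b ∷ w))

  -- As a minimum in front, `b` adds no inversions, and arrangements of `b ∷ C` that start otherwise
  -- contribute nothing, so all of them may be summed.
  extend-below : ∀ m {b C} → All (b <_) C → Increasing C → length C ≡ m → extend m b C ≈ U (suc m)
  extend-below m {b} {C} b< inc len = begin
    ∑ (arr m C) (λ w → qinv q w ⊗ u (b ∷ w))
      ≈⟨ ∑-cong (arr m C) (λ {w} w∈ → ⊗-congʳ (qinv-min (arr-all len b< w∈))) ⟨
    ∑ (arr m C) (λ w → qinv q (b ∷ w) ⊗ u (b ∷ w))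
      ≈⟨ ∑-arr-min m len b< _ (λ x w b∈ b<x → ≈-trans (⊗-congˡ (u-vanishes x w b∈ b<x)) (zeroʳ _)) ⟨
    ∑ (arr (suc m) (b ∷ C)) (λ w → qinv q w ⊗ u w)
      ≈⟨ ∑-arr-invariant (b< ∷ inc) (cong suc len) (qinv-invariant q u-invariant) ⟩
    U (suc m) ∎

  extend-above : ∀ m {a b C} → a < b → length (a ∷ C) ≡ m → extend m b (a ∷ C) ≈ 0#
  extend-above m {a} {b} {C} a<b len = ∑-zero (arr m (a ∷ C)) (λ {w} w∈ → ≈-trans
    (⊗-congˡ (u-vanishes b w (∈-resp-↭ (↭-sym (arr-↭ m len w∈)) (here refl)) a<b)) (zeroʳ _))

  -- The words on B that reduce to α are a single one, ending at entry s of B if α ends with s.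
  ∑-arr-red : ∀ {α B} → IsPerm p α → Increasing B → length B ≡ p → (X : ℕ → Carrier) →
    ∑ (arr p B) (λ v → qinv q v ⊗ guard (red v ≟L α) (pow z (des v) ⊗ X (lastElem v))) ≈
    pow z (des α) ⊗ qinv q α ⊗ X (at B (pred (lastElem α)))
  ∑-arr-red {α} {B} perm inc len X = begin
    ∑ (arr p B) (λ v → qinv q v ⊗ guard (red v ≟L α) (pow z (des v) ⊗ X (lastElem v)))
      ≈⟨ ∑-arr-at {B} len g ⟩
    ∑ (arr p (iota p)) (g ∘ map φ)
      ≈⟨ ∑-cong (arr p (iota p)) (λ {v} v∈ → term v (arr-length p {iota p} v∈)
           (arr-↭ p (length-iota p) v∈) (mono-arr inc len v∈)) ⟩
    ∑ (arr p (iota p)) (λ v → guard (v ≟L α) (pow z (des v) ⊗ qinv q v ⊗ X (φ (lastElem v))))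
      ≈⟨ ∑-arr-≡ perm _ ⟩
    pow z (des α) ⊗ qinv q α ⊗ X (φ (lastElem α)) ∎
    where
    φ : ℕ → ℕ
    φ = at B ∘ pred
    g : List ℕ → Carrier
    g v = qinv q v ⊗ guard (red v ≟L α) (pow z (des v) ⊗ X (lastElem v))
    term : ∀ v → length v ≡ p → v ↭ iota p → Mono φ v →
      g (map φ v) ≈
      guard (v ≟L α) (pow z (des v) ⊗ qinv q v ⊗ X (φ (lastElem v)))
    term v@(x ∷ w) _ v↭ mono = begin
      g (map φ v)
        ≈⟨ ⊗-cong (reflexive (cong (pow q) (inv-map v mono)))
             (guard-⇔ (red (map φ v) ≟L α) (v ≟L α) (trans (sym same)) (trans same)) ⟩
      qinv q v ⊗ guard (v ≟L α) (pow z (des (map φ v)) ⊗ X (lastElem (map φ v)))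
        ≈⟨ ⊗-congˡ (guard-cong (v ≟L α) (λ _ → reflexive (cong₂ (λ n b → pow z n ⊗ X b)
             (des-map v mono) (lastElem-map φ x w)))) ⟩
      qinv q v ⊗ guard (v ≟L α) (pow z (des v) ⊗ X (φ (lastElem v)))
        ≈⟨ guard-⊗ʳ (v ≟L α) _ _ ⟩
      guard (v ≟L α) (qinv q v ⊗ (pow z (des v) ⊗ X (φ (lastElem v))))
        ≈⟨ guard-cong (v ≟L α) (λ _ → ≈-trans (≈-sym (⊗-assoc _ _ _)) (⊗-congʳ (⊗-comm _ _))) ⟩
      guard (v ≟L α) (pow z (des v) ⊗ qinv q v ⊗ X (φ (lastElem v))) ∎
      where
      same : red (map φ v) ≡ v
      same = trans (red-map v mono) (red-perm v↭)

  front-at : List ℕ → List ℕ → List ℕ → Carrier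
  front-at α v w = guard (red v ≟L α) (pow z (des v) ⊗ u (lastElem v ∷ w))

  lastElem-perm : ∀ {α} → IsPerm p α → ∃ λ r → r < p × lastElem α ≡ suc r
  lastElem-perm {x ∷ w} perm = ∈-iota⁻ (All.lookup (isPerm⇒⊆iota perm) (lastElem-∈ x w))

  -- For fixed `B` one arrangement reduces to `α`, and it ends with entry `r` of `B`, where
  -- `lastElem α` is `suc r`. The continuation survives only if that entry lies below all of `C`,
  -- which is the situation of `∑-splits-initial`.
  front-at-sum : ∀ m {α} → IsPerm p α →
    permSum q (λ σ → front-at α (take p σ) (drop p σ)) (p + m) ≈
    pow z (des α) ⊗ qinv q α ⊗ qbin q (p + m ∸ lastElem α) (p ∸ lastElem α) ⊗ U (suc m)
  front-at-sum m {α} perm with lastElem-perm perm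
  ... | r , r<p , last≡ = begin
    permSum q (λ σ → front-at α (take p σ) (drop p σ)) (p + m)
      ≈⟨ ∑-arr-shuffle q p m (length-iota (p + m)) (front-at α) ⟩
    ∑ S (λ (B , C) → pow q (cross B C) ⊗
      ∑ (arr p B) (λ v → qinv q v ⊗ ∑ (arr m C) (λ w → qinv q w ⊗ front-at α v w)))
      ≈⟨ ∑-cong S (λ {(B , C)} s → ≈-trans (⊗-congˡ (term s)) (⊗-swapˡ _ _ _)) ⟩
    ∑ S (λ (B , C) → (pow z (des α) ⊗ qinv q α) ⊗ (pow q (cross B C) ⊗ extend m (at B r) C))
      ≈⟨ ∑-⊗ˡ _ S _ ⟩
    (pow z (des α) ⊗ qinv q α) ⊗ ∑ S (λ (B , C) → pow q (cross B C) ⊗ extend m (at B r) C)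
      ≈⟨ ⊗-congˡ (∑-splits-initial q p m r (increasing-iota (p + m)) (length-iota (p + m)) r<p
           (extend m) (U (suc m)) (extend-below m) (extend-above m)) ⟩
    (pow z (des α) ⊗ qinv q α) ⊗ (qbin q (length (iota (p + m)) ∸ suc r) (p ∸ suc r) ⊗ U (suc m))
      ≈⟨ ⊗-assoc _ _ _ ⟨
    pow z (des α) ⊗ qinv q α ⊗ qbin q (length (iota (p + m)) ∸ suc r) (p ∸ suc r) ⊗ U (suc m)
      ≡⟨ cong₂ (λ n s → pow z (des α) ⊗ qinv q α ⊗ qbin q (n ∸ s) (p ∸ s) ⊗ U (suc m))
           (length-iota (p + m)) (sym last≡) ⟩
    pow z (des α) ⊗ qinv q α ⊗ qbin q (p + m ∸ lastElem α) (p ∸ lastElem α) ⊗ U (suc m) ∎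
    where
    S = splits p (iota (p + m))
    term : ∀ {B C} → (B , C) ∈ S →
      ∑ (arr p B) (λ v → qinv q v ⊗ ∑ (arr m C) (λ w → qinv q w ⊗ front-at α v w)) ≈
      pow z (des α) ⊗ qinv q α ⊗ extend m (at B r) C
    term {B} {C} s = ≈-trans
      (∑-cong (arr p B) (λ {v} _ → ⊗-congˡ (begin
        ∑ (arr m C) (λ w → qinv q w ⊗ front-at α v w)
          ≈⟨ ∑-cong (arr m C) (λ {w} _ → ≈-trans (guard-⊗ʳ (red v ≟L α) _ _)
               (guard-cong (red v ≟L α) (λ _ → ⊗-swapˡ _ _ _))) ⟩
        ∑ (arr m C) (λ w → guard (red v ≟L α) (pow z (des v) ⊗ (qinv q w ⊗ u (lastElem v ∷ w))))
          ≈⟨ ∑-guard (red v ≟L α) (arr m C) _ ⟩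
        guard (red v ≟L α) (∑ (arr m C) (λ w → pow z (des v) ⊗ (qinv q w ⊗ u (lastElem v ∷ w))))
          ≈⟨ guard-cong (red v ≟L α) (λ _ → ∑-⊗ˡ _ (arr m C) _) ⟩
        guard (red v ≟L α) (pow z (des v) ⊗ extend m (lastElem v) C) ∎)))
      (≈-trans (∑-arr-red perm (proj₁ (splits-increasing p (increasing-iota (p + m)) s))
                 (splits-lengthˡ p {iota (p + m)} s) (λ b → extend m b C))
               (⊗-congˡ (reflexive (cong (λ s → extend m (at B (pred s)) C) last≡))))

  front-sum : ∀ m → Unique Γ → permSum q front (p + m) ≈
    ∑ Γ (λ α → pow z (des α) ⊗ qinv q α ⊗ qbin q (p + m ∸ lastElem α) (p ∸ lastElem α) ⊗ U (suc m))
  front-sum m unique-Γ = begin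
    ∑ P (λ σ → qinv q σ ⊗ front σ)
      ≈⟨ ∑-cong P (λ {σ} σ∈ → ⊗-congˡ (term σ (arr-length (p + m) {iota (p + m)} σ∈))) ⟩
    ∑ P (λ σ → qinv q σ ⊗ ∑ Γ (λ α → front-at α (take p σ) (drop p σ)))
      ≈⟨ ∑-cong P (λ {σ} _ → ∑-⊗ˡ (qinv q σ) Γ _) ⟨
    ∑ P (λ σ → ∑ Γ (λ α → qinv q σ ⊗ front-at α (take p σ) (drop p σ)))
      ≈⟨ ∑-comm P Γ _ ⟩
    ∑ Γ (λ α → permSum q (λ σ → front-at α (take p σ) (drop p σ)) (p + m))
      ≈⟨ ∑-cong Γ (λ {α} α∈ → front-at-sum m (proj₁ (All.lookup admissible α∈))) ⟩
    ∑ Γ (λ α → pow z (des α) ⊗ qinv q α ⊗ qbin q (p + m ∸ lastElem α) (p ∸ lastElem α) ⊗ U (suc m)) ∎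
    where
    P = arr (p + m) (iota (p + m))
    term : ∀ σ → length σ ≡ p + m → front σ ≈ ∑ Γ (λ α → front-at α (take p σ) (drop p σ))
    term σ len = ≈-trans
      (∑-guard-∈ {_≟′_ = _≟L_} (red (take p σ)) Γ (occurs? 0 σ) unique-Γ _)
      (∑-cong Γ (λ {α} _ → guard-cong (red (take p σ) ≟L α) (λ _ → ⊗-congˡ (reflexive (cong u
        (drop-lastElem (suc d) σ (≤-trans (m≤m+n p m) (≤-reflexive (sym len)))))))))

  -- Uniqueness of the reciprocal series

  qbin-> : ∀ n k → n < k → qbin q n k ≈ 0#
  qbin-> zero    (suc k) _       = ≈-refl
  qbin-> (suc n) (suc k) (s≤s lt) = ≈-trans
    (⊕-cong (qbin-> n k lt) (≈-trans (⊗-congˡ (qbin-> n (suc k) (m<n⇒m<1+n lt))) (zeroʳ _)))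
    (⊕-identityˡ 0#)

  qbin-diag : ∀ n → qbin q n n ≈ 1#
  qbin-diag zero    = ≈-refl
  qbin-diag (suc n) = ≈-trans
    (⊕-cong (qbin-diag n) (≈-trans (⊗-congˡ (qbin-> n (suc n) ≤-refl)) (zeroʳ _))) (⊕-identityʳ 1#)

  convCoeff-last : ∀ V n → convCoeff p Γ q z V n ≈
    ∑ (upTo n) (λ k → qbin q n k ⊗ V k ⊗ INM p Γ q z (n ∸ k)) ⊕ V n
  convCoeff-last V n = ≈-trans (∑-upTo-last n _) (⊕-congˡ (begin
    qbin q n n ⊗ V n ⊗ INM p Γ q z (n ∸ n)
      ≈⟨ ⊗-cong (⊗-congʳ (qbin-diag n)) (reflexive (cong (INM p Γ q z) (n∸n≡0 n))) ⟩
    1# ⊗ V n ⊗ 1# ≈⟨ ⊗-identityʳ _ ⟩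
    1# ⊗ V n      ≈⟨ ⊗-identityˡ _ ⟩
    V n           ∎))

  -- The term `k = n` of the n-th convolution is `V n` itself, because `qbin q n n` and `INM` at 0
  -- are both 1; the earlier terms agree by induction and cancel additively.
  reciprocal-unique : ∀ V W → V 0 ≈ W 0 →
    (∀ n → 1 ≤ n → convCoeff p Γ q z V n ≈ 0#) → (∀ n → 1 ≤ n → convCoeff p Γ q z W n ≈ 0#) →
    ∀ n → V n ≈ W n
  reciprocal-unique V W eq₀ conv-V conv-W = <-rec _ step
    where
    step : ∀ n → (∀ {k} → k < n → V k ≈ W k) → V n ≈ W n
    step zero    ih = eq₀
    step (suc n) ih = +-cancelˡ (earlier V) _ _ (begin
      earlier V ⊕ V (suc n)       ≈⟨ convCoeff-last V (suc n) ⟨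
      convCoeff p Γ q z V (suc n) ≈⟨ conv-V (suc n) z<s ⟩
      0#                          ≈⟨ conv-W (suc n) z<s ⟨
      convCoeff p Γ q z W (suc n) ≈⟨ convCoeff-last W (suc n) ⟩
      earlier W ⊕ W (suc n)
        ≈⟨ ⊕-congʳ (∑-cong (upTo (suc n)) (λ {k} k∈ → ⊗-congʳ (⊗-congˡ (ih (∈-upTo⁻ k∈))))) ⟨
      earlier V ⊕ W (suc n)       ∎)
      where
      earlier : (ℕ → Carrier) → Carrier
      earlier X = ∑ (upTo (suc n)) (λ k → qbin q (suc n) k ⊗ X k ⊗ INM p Γ q z (suc n ∸ k))

theorem5p1 : ∀ {c ℓ : Level} (R : CommutativeRing c ℓ) →
    let open CommutativeRing R
        open RingDefs R
    in (p : ℕ) (Γ : List (List ℕ)) →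
       3 ≤ p → Unique Γ → All (Admissible p) Γ → AllPairs (MutMinOverlapping p) Γ →
       (q z : Carrier) (IU : ℕ → Carrier) →
       IU 0 ≈ 1# →
       (∀ n → 1 ≤ n → convCoeff p Γ q z IU n ≈ 0#) →
       (IU 1 ≈ - z)
       × (∀ n → 2 ≤ n → n < p → IU n ≈ (1# + - z) * IU (n ∸ 1))
       × (∀ n → p ≤ n →
            IU n ≈ (1# + - z) * IU (n ∸ 1)
                   + - sumR (map (λ α → pow z (des α) * pow q (inv α)
                                        * qbin q (n ∸ lastElem α) (p ∸ lastElem α)
                                        * IU (suc (n ∸ p))) Γ))
theorem5p1 R (suc (suc d)) Γ (s≤s (s≤s _)) unique-Γ admissible mutual-minimal q z IU IU-0 conv =
  ≈-trans (IU≈U 1) U-1 , short , long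
  where
  open Sums R
  open PermSums R
  open N using (_+_)
  open Matching d Γ admissible mutual-minimal using (p)
  open Clusters R d Γ admissible mutual-minimal q z
  IU≈U : ∀ n → IU n ≈ U n
  IU≈U = reciprocal-unique IU U
    (≈-trans IU-0 (≈-sym (≈-trans (⊕-identityʳ _) (⊗-identityʳ _)))) conv convolution
  IU-suc : ∀ n → IU (suc (suc n)) ≈
    (1# ⊕ ⊖ z) ⊗ IU (suc n) ⊕ ⊖ permSum q front (suc (suc n))
  IU-suc n = ≈-trans (IU≈U (suc (suc n))) (≈-trans (U-suc n)
    (⊕-congʳ (⊗-congˡ (≈-sym (IU≈U (suc n))))))
  short : ∀ n → 2 ≤ n → n < p → IU n ≈ (1# ⊕ ⊖ z) ⊗ IU (n ∸ 1)
  short (suc (suc n)) (s≤s (s≤s _)) n<p = ≈-trans (IU-suc n) (≈-trans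
    (⊕-congˡ (≈-trans (-‿cong (front-sum-short (suc (suc n)) n<p)) -0#≈0#)) (⊕-identityʳ _))
  long : ∀ n → p ≤ n → IU n ≈ (1# ⊕ ⊖ z) ⊗ IU (n ∸ 1) ⊕ ⊖ ∑ Γ (λ α →
    pow z (des α) ⊗ pow q (inv α) ⊗ qbin q (n ∸ lastElem α) (p ∸ lastElem α) ⊗ IU (suc (n ∸ p)))
  -- Replacing `n` by `p + m` turns the index n - p + 1 into `suc m`, the size of the word that
  -- starts at the last letter of the match.
  long n p≤n with n ∸ p | m+[n∸m]≡n p≤n
  ... | m | refl = ≈-trans (IU-suc (d + m)) (⊕-congˡ (-‿cong (≈-trans (front-sum m unique-Γ)
    (∑-cong Γ (λ _ → ⊗-congˡ (≈-sym (IU≈U (suc m))))))))
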